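{- Let $n\ge0$ and let $H_n$ be the pyrene system with $n$ pyrene fragments. Then the sum of the anti-forcing numbers of all perfect matchings of $H_n$ is $$\sum_{M}af(H_n,M)=\frac{3\sqrt{2}}{64}(3-2\sqrt{2})^n+\frac{17-12\sqrt{2}}{16}n(3-2\sqrt{2})^n-\frac{3\sqrt{2}}{64}(3+2\sqrt{2})^n+\frac{17+12\sqrt{2}}{16}n(3+2\sqrt{2})^n.$$
   Context: Pyrene system: draw the hexagonal lattice so that every hexagon has two vertical sides; horizontally adjacent hexagons then share a vertical edge. For $n\ge1$, $H_n$ is the hexagonal system (the plane graph formed by the vertices and edges of the following $4n$ hexagons) consisting of a horizontal linear row of $2n$ hexagons $h_{1,1},h_{1,2},\dots,h_{n,1},h_{n,2}$, consecutive ones sharing a vertical edge, together with, for each $i$, a hexagon $s_{i,1}$ directly above and a hexagon $s_{i,2}$ directly below the common edge of $h_{i,1}$ and $h_{i,2}$ (each sharing an edge with both $h_{i,1}$ and $h_{i,2}$). $H_0$ is the null graph, which has one (empty) perfect matching with anti-forcing number $0$. For a perfect matching $M$ of $G$, an anti-forcing set of $M$ is a set $S\subseteq E(G)\setminus M$ such that $M$ is the unique perfect matching of $G-S$; the anti-forcing number $af(G,M)$ is the minimum size of an anti-forcing set of $M$. The sum is over all perfect matchings $M$ of $H_n$ (equivalently, it is $\frac{d}{dx}Af(H_n,x)|_{x=1}$ with $Af(G,x)=\sum_M x^{af(G,M)}$). -}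

module Defs where

open import Data.Bool.Properties using () renaming (_≟_ to _≟ᵇ_)
open import Data.Fin using (Fin)
open import Data.Fin.Properties using (all?; any?) renaming (_≟_ to _≟ᶠ_)
open import Data.Fin.Subset using (Subset; inside; outside; _∈_; _⊆_; ∁; ⊤; ∣_∣)
open import Data.Fin.Subset.Properties using (_∈?_; _⊆?_; ⊆-refl; ⊆-antisym; x∈p⇒x∉∁p; x∉∁p⇒x∈p; x∈∁p⇒x∉p; x∉p⇒x∈∁p)
open import Data.Integer using (+_)
open import Data.List using (List; []; _∷_; _++_; map; filter; length; lookup; concatMap; deduplicate; downFrom)
open import Data.List.Extrema.Nat using (argmin; argmin-all; f[argmin]≤f[xs])
open import Data.List.Membership.Propositional using () renaming (_∈_ to _∈ˡ_)
open import Data.List.Membership.Propositional.Properties using (∈-map⁺; ∈-map⁻; ∈-++⁺ˡ; ∈-++⁺ʳ; ∈-deduplicate⁺; ∈-filter⁺; ∈-concatMap⁺; ∈-concatMap⁻; ∈-lookup)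
open import Data.List.Relation.Unary.All using (All; []; _∷_) renaming (all? to allˡ?; lookup to lookupᴬ; tabulate to tabulateᴬ)
open import Data.List.Relation.Unary.All.Properties using (all-filter; deduplicate⁺)
open import Data.List.Relation.Unary.Any using (Any; here; there) renaming (map to mapᴱ)
open import Data.List.Relation.Unary.Unique.Propositional using (Unique; []; _∷_)
open import Data.List.Relation.Unary.Unique.Propositional.Properties using (map⁺; ++⁺)
open import Data.Nat using (ℕ; zero; suc; _≤_; NonZero) renaming (_+_ to _+ⁿ_; _*_ to _*ⁿ_; _≟_ to _≟ⁿ_)
open import Data.Nat.ListAction using (sum)
open import Data.Product using (∃; ∃!; _×_; _,_; proj₁; proj₂)
open import Data.Product.Properties using () renaming (≡-dec to ×-≡-dec)
open import Data.Rational using (ℚ; 0ℚ; 1ℚ; _/_) renaming (_+_ to _+ᵠ_; _*_ to _*ᵠ_; _-_ to _-ᵠ_)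
open import Data.Sum using (_⊎_; inj₁; inj₂)
open import Data.Vec using ([]; _∷_)
open import Data.Vec.Properties using (∷-injectiveʳ) renaming (≡-dec to Vec-≡-dec)
open import Relation.Binary.Definitions using (DecidableEquality)
open import Relation.Binary.PropositionalEquality using (_≡_; refl; sym; trans; subst)
open import Relation.Nullary using (Dec; ¬_)
open import Relation.Nullary.Decidable using (map′; _×-dec_; _⊎-dec_; _→-dec_)

subsets : ∀ m → List (Subset m)
subsets zero    = [] ∷ []
subsets (suc m) = map (outside ∷_) (subsets m) ++ map (inside ∷_) (subsets m)

∈-subsets : ∀ {m} (p : Subset m) → p ∈ˡ subsets m
∈-subsets []                   = here refl
∈-subsets (outside ∷ p)        = ∈-++⁺ˡ (∈-map⁺ (outside ∷_) (∈-subsets p))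
∈-subsets {suc m} (inside ∷ p) = ∈-++⁺ʳ (map (outside ∷_) (subsets m)) (∈-map⁺ (inside ∷_) (∈-subsets p))

subsets-unique : ∀ m → Unique (subsets m)
subsets-unique zero    = [] ∷ []
subsets-unique (suc m) = ++⁺ (map⁺ ∷-injectiveʳ (subsets-unique m)) (map⁺ ∷-injectiveʳ (subsets-unique m)) disjoint
  where
  disjoint : ∀ {p} → ¬ (p ∈ˡ map (outside ∷_) (subsets m) × p ∈ˡ map (inside ∷_) (subsets m))
  disjoint (p∈o , p∈i) with ∈-map⁻ (outside ∷_) p∈o | ∈-map⁻ (inside ∷_) p∈i
  ... | _ , _ , refl | _ , _ , ()

-- An edge is listed once, in one of its two orientations; the orientation
-- carries no meaning.
record Graph : Set₁ where
  field
    V         : Set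
    _≟_       : DecidableEquality V
    vertices  : List V
    edges     : List (V × V)
    endpoints : All (λ (u , v) → u ∈ˡ vertices × v ∈ˡ vertices) edges

  -- Edges are referred to by their position in the list.
  Edge : Set
  Edge = Fin (length edges)

  EdgeSet : Set
  EdgeSet = Subset (length edges)

  Incident : V → Edge → Set
  Incident v e = v ≡ proj₁ (lookup edges e) ⊎ v ≡ proj₂ (lookup edges e)

  incident? : ∀ v e → Dec (Incident v e)
  incident? v e = (v ≟ proj₁ (lookup edges e)) ⊎-dec (v ≟ proj₂ (lookup edges e))

  CoveredOnce : EdgeSet → V → Set
  CoveredOnce M v = ∃! _≡_ (λ e → e ∈ M × Incident v e)

  coveredOnce? : ∀ M v → Dec (CoveredOnce M v)
  coveredOnce? M v =
    any? λ e → P? e ×-dec map′ (λ h {f} → h f) (λ h f → h {f}) (all? λ f → P? f →-dec (e ≟ᶠ f))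
    where
    P? : ∀ e → Dec (e ∈ M × Incident v e)
    P? e = (e ∈? M) ×-dec incident? v e

  -- M is a perfect matching of the spanning subgraph with edge set A.
  PerfectMatchingIn : EdgeSet → EdgeSet → Set
  PerfectMatchingIn A M = M ⊆ A × All (CoveredOnce M) vertices

  perfectMatchingIn? : ∀ A M → Dec (PerfectMatchingIn A M)
  perfectMatchingIn? A M = (M ⊆? A) ×-dec allˡ? (coveredOnce? M) vertices

  PerfectMatching : EdgeSet → Set
  PerfectMatching = PerfectMatchingIn ⊤

  -- ∁ S is the edge set of the graph with the edges of S deleted.
  AntiForcing : EdgeSet → EdgeSet → Set
  AntiForcing M S =
    S ⊆ ∁ M × PerfectMatchingIn (∁ S) M × (∀ N → PerfectMatchingIn (∁ S) N → N ≡ M)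

  antiForcing? : ∀ M S → Dec (AntiForcing M S)
  antiForcing? M S =
    (S ⊆? ∁ M) ×-dec perfectMatchingIn? (∁ S) M ×-dec
    map′ (λ h N → lookupᴬ h (∈-subsets N)) (λ h → tabulateᴬ (λ {N} _ → h N))
      (allˡ? (λ N → perfectMatchingIn? (∁ S) N →-dec Vec-≡-dec _≟ᵇ_ N M) (subsets _))

  perfectMatchings : List EdgeSet
  perfectMatchings = filter (perfectMatchingIn? ⊤) (subsets _)

  antiForcingSets : EdgeSet → List EdgeSet
  antiForcingSets M = filter (antiForcing? M) (subsets _)

  -- argmin needs a default; ∁ M is itself an anti-forcing set of a perfect
  -- matching M (∁-antiForcing), so it does not affect the minimum.
  af : EdgeSet → ℕ
  af M = ∣ argmin ∣_∣ (∁ M) (antiForcingSets M) ∣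

  afSum : ℕ
  afSum = sum (map af perfectMatchings)

  ∁-antiForcing : ∀ {M} → PerfectMatching M → AntiForcing M (∁ M)
  ∁-antiForcing {M} (_ , cov) =
    ⊆-refl , ((λ e∈M → x∉p⇒x∈∁p (x∈p⇒x∉∁p e∈M)) , cov) , unique
    where
    unique : ∀ N → PerfectMatchingIn (∁ (∁ M)) N → N ≡ M
    unique N (N⊆ , covN) = ⊆-antisym N⊆M M⊆N
      where
      N⊆M : N ⊆ M
      N⊆M e∈N = x∉∁p⇒x∈p (x∈∁p⇒x∉p (N⊆ e∈N))

      M⊆N : M ⊆ N
      M⊆N {e} e∈M with lookupᴬ covN u∈V | lookupᴬ cov u∈V
        where
        u∈V : proj₁ (lookup edges e) ∈ˡ vertices
        u∈V = proj₁ (lookupᴬ endpoints (∈-lookup e))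
      ... | f , (f∈N , u~f) , _ | _ , _ , only =
        subst (_∈ N) (trans (sym (only (N⊆M f∈N , u~f))) (only (e∈M , inj₁ refl))) f∈N

  af-attained : ∀ {M} → PerfectMatching M → ∃ λ S → AntiForcing M S × ∣ S ∣ ≡ af M
  af-attained {M} pm =
    _ , argmin-all ∣_∣ (∁-antiForcing pm) (all-filter (antiForcing? M) (subsets _)) , refl

  af-minimal : ∀ {M S} → AntiForcing M S → af M ≤ ∣ S ∣
  af-minimal {M} {S} h =
    lookupᴬ (f[argmin]≤f[xs] {f = ∣_∣} (∁ M) (antiForcingSets M)) (∈-filter⁺ (antiForcing? M) (∈-subsets S) h)

-- The hexagonal lattice is drawn as a brick wall in ℕ × ℕ: the hexagon with
-- lower-left corner (x , y) is the boundary of the 2 × 1 brick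
--
--   (x , 1+y) ── (1+x , 1+y) ── (2+x , 1+y)
--       │                            │
--   (x ,  y ) ── (1+x ,  y ) ── (2+x ,  y )
--
-- Edges are oriented rightwards or upwards, so that the edge shared by two
-- hexagons is the same pair for both.
Point : Set
Point = ℕ × ℕ

_≟ᵖ_ : DecidableEquality Point
_≟ᵖ_ = ×-≡-dec _≟ⁿ_ _≟ⁿ_

hexVertices : Point → List Point
hexVertices (x , y) =
  (x , y)     ∷ (1 +ⁿ x , y)     ∷ (2 +ⁿ x , y) ∷
  (x , suc y) ∷ (1 +ⁿ x , suc y) ∷ (2 +ⁿ x , suc y) ∷ []

hexEdges : Point → List (Point × Point)
hexEdges (x , y) =
  ((x , y) , (1 +ⁿ x , y))         ∷ ((1 +ⁿ x , y) , (2 +ⁿ x , y)) ∷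
  ((x , suc y) , (1 +ⁿ x , suc y)) ∷ ((1 +ⁿ x , suc y) , (2 +ⁿ x , suc y)) ∷
  ((x , y) , (x , suc y))          ∷ ((2 +ⁿ x , y) , (2 +ⁿ x , suc y)) ∷ []

hexEndpoints : ∀ h → All (λ (u , v) → u ∈ˡ hexVertices h × v ∈ˡ hexVertices h) (hexEdges h)
hexEndpoints h = (v₀ , v₁) ∷ (v₁ , v₂) ∷ (v₃ , v₄) ∷ (v₄ , v₅) ∷ (v₀ , v₃) ∷ (v₂ , v₅) ∷ []
  where
  v₀ = here refl
  v₁ = there (here refl)
  v₂ = there (there (here refl))
  v₃ = there (there (there (here refl)))
  v₄ = there (there (there (there (here refl))))
  v₅ = there (there (there (there (there (here refl)))))

hexagonalSystem : List Point → Graph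
hexagonalSystem hs = record
  { V         = Point
  ; _≟_       = _≟ᵖ_
  ; vertices  = vs
  ; edges     = deduplicate (×-≡-dec _≟ᵖ_ _≟ᵖ_) (concatMap hexEdges hs)
  ; endpoints = deduplicate⁺ (×-≡-dec _≟ᵖ_ _≟ᵖ_) (tabulateᴬ λ e∈ →
      let e∈h = ∈-concatMap⁻ hexEdges {xs = hs} e∈ in
      vertex (mapᴱ (λ {h} e∈ → proj₁ (lookupᴬ (hexEndpoints h) e∈)) e∈h) ,
      vertex (mapᴱ (λ {h} e∈ → proj₂ (lookupᴬ (hexEndpoints h) e∈)) e∈h))
  }
  where
  vs : List Point
  vs = deduplicate _≟ᵖ_ (concatMap hexVertices hs)

  vertex : ∀ {v} → Any (λ h → v ∈ˡ hexVertices h) hs → v ∈ˡ vs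
  vertex v∈ = ∈-deduplicate⁺ _≟ᵖ_ (∈-concatMap⁺ hexVertices v∈)

-- With i counted from 0: the hexagons h₁, h₂ of the horizontal row share the
-- edge (4i+2 , 1) ── (4i+2 , 2); s₁ lies above it and s₂ below it.
pyrene : ℕ → List Point
pyrene i =
  (4 *ⁿ i       , 1) ∷   -- h₁
  (2 +ⁿ 4 *ⁿ i  , 1) ∷   -- h₂
  (1 +ⁿ 4 *ⁿ i  , 2) ∷   -- s₁
  (1 +ⁿ 4 *ⁿ i  , 0) ∷   -- s₂
  []

H : ℕ → Graph
H n = hexagonalSystem (concatMap pyrene (downFrom n))

-- The field ℚ(√2), a subfield of ℝ: a +√2 b stands for a + b√2.
infix 5 _+√2_
record ℚ[√2] : Set where
  constructor _+√2_
  field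
    rat irr : ℚ

infix  9 #_
infixl 6 _+_ _-_
infixl 7 _*_ _÷_
infixr 8 _^_

_+_ _-_ _*_ : ℚ[√2] → ℚ[√2] → ℚ[√2]
(a +√2 b) + (c +√2 d) = (a +ᵠ c) +√2 (b +ᵠ d)
(a +√2 b) - (c +√2 d) = (a -ᵠ c) +√2 (b -ᵠ d)
(a +√2 b) * (c +√2 d) = (a *ᵠ c +ᵠ (+ 2 / 1) *ᵠ (b *ᵠ d)) +√2 (a *ᵠ d +ᵠ b *ᵠ c)

_÷_ : ℚ[√2] → (k : ℕ) → .{{NonZero k}} → ℚ[√2]
(a +√2 b) ÷ k = (a *ᵠ (+ 1 / k)) +√2 (b *ᵠ (+ 1 / k))

#_ : ℕ → ℚ[√2]
# k = (+ k / 1) +√2 0ℚ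

√2 : ℚ[√2]
√2 = 0ℚ +√2 1ℚ

_^_ : ℚ[√2] → ℕ → ℚ[√2]
x ^ zero  = # 1
x ^ suc k = x * x ^ k

{-# OPTIONS --safe #-}
-- The two vertices shared by consecutive fragments are both matched to the
-- left, both to the right, or to each other.  Hence each pyrene fragment is in
-- one of six states: both x y, where s₁ and s₂ are alternating hexagons in
-- state x or y ∈ {L , R}, and inˡ (inʳ), where the fragment is matched to its
-- two left (right) port vertices.  Perfect matchings of H n correspond to words
-- of length n over these six letters in which inʳ is never followed by inˡ.
--
-- The anti-forcing number is additive over the letters: both L L and both R R
-- contribute 3, both L R and both R L contribute 2, inˡ and inʳ contribute 1.
-- It is at least this sum because every anti-forcing set meets every
-- alternating cycle, and there are that many alternating cycles without common
-- edges outside the matching.  It is at most this sum because one edge of each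
-- cycle can be chosen so that deleting them leaves only one admissible word.
--
-- A linear recurrence then gives the sum over all words in terms of the
-- coefficients of (3 + 2√2)ⁿ = x + 2z√2.
module Submission where

open import Defs
open import Data.Bool using (Bool; true; false; not; _∨_; if_then_else_)
open import Data.Bool.Properties using (¬-not; ∨-zeroʳ)
open import Data.Empty using (⊥; ⊥-elim)
open import Data.Fin using (Fin; zero; suc; toℕ) renaming (#_ to #ᶠ_)
open import Data.Fin.Patterns using (0F; 1F; 2F; 3F)
open import Data.Fin.Properties using (any?) renaming (suc-injective to sucᶠ-injective)
open import Data.Fin.Subset using (Subset; _∈_; _∉_; ∁; ⊤; ∣_∣; inside; outside; _∩_)
open import Data.Fin.Subset.Properties using (_∈?_; ⊆-antisym; ⊆⊤; x∈p∩q⁺; x∈p∩q⁻; nonempty?; x∈∁p⇒x∉p; x∉p⇒x∈∁p)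
import Data.Integer as ℤ
import Data.Integer.Properties as ℤ
open import Data.List using (List; []; _∷_; _++_; map; concat; concatMap; length; lookup; applyUpTo; downFrom)
open import Data.List.Membership.Propositional using (find; lose) renaming (_∈_ to _∈ˡ_)
import Data.List.Membership.DecPropositional as DecMembership
open import Data.List.Membership.Propositional.Properties using (∈-lookup; ∈-map⁺; ∈-map⁻; ∈-concatMap⁺; ∈-concatMap⁻; ∈-downFrom⁺; ∈-downFrom⁻; ∈-deduplicate⁺; ∈-deduplicate⁻; ∈-∃++; ∈-++⁻; ∈-++⁺ˡ; ∈-++⁺ʳ; ∈-filter⁺; ∈-filter⁻; ∈-concat⁺′; ∈-concat⁻′; ∈-applyUpTo⁺; ∈-applyUpTo⁻)
open import Data.List.Membership.Propositional.Properties.WithK using (unique∧set⇒bag)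
open import Data.List.Properties using (length-map; length-++; map-∘; map-++; map-cong-local)
open import Data.List.Relation.Binary.BagAndSetEquality using (∼bag⇒↭)
open import Data.List.Relation.Binary.Disjoint.Propositional using (Disjoint)
open import Data.List.Relation.Binary.Permutation.Propositional using (_↭_)
open import Data.List.Relation.Binary.Permutation.Propositional.Properties using () renaming (map⁺ to ↭-map⁺)
open import Data.List.Relation.Unary.All using (All; []; _∷_) renaming (lookup to lookupᴬ; tabulate to tabulateᴬ)
import Data.List.Relation.Unary.All.Properties as All
open import Data.List.Relation.Unary.AllPairs using () renaming (map to mapᴾ)
import Data.List.Relation.Unary.AllPairs.Properties as AllPairs
open import Data.List.Relation.Unary.Any using (here; there; index)
open import Data.List.Relation.Unary.Any.Properties using (lookup-index)
open import Data.List.Relation.Unary.Unique.DecPropositional.Properties using (deduplicate-!)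
open import Data.List.Relation.Unary.Unique.Propositional using (Unique; []; _∷_)
import Data.List.Relation.Unary.Unique.Propositional.Properties as Unique
open import Data.Maybe using (Maybe; just; nothing)
open import Data.Maybe.Properties using (just-injective)
open import Data.Nat using (ℕ; zero; suc; pred; _<_; _≤_; _<?_; z≤n; s≤s) renaming (_+_ to _+ⁿ_; _*_ to _*ⁿ_; _≟_ to _≟ⁿ_)
open import Data.Nat.ListAction using (sum)
open import Data.Nat.ListAction.Properties using (sum-++; sum-↭)
open import Data.Nat.Properties using (*-suc; *-zeroʳ; ≤-antisym; ≤-trans; ≤-reflexive; <⇒≤; <⇒≢; <⇒≱; ≮⇒≥; 1+n≢n; suc-injective; m≤m+n; +-suc; +-comm; +-cancelʳ-≡; module ≤-Reasoning)
open import Data.Nat.Tactic.RingSolver using (solve-∀)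
open import Data.Product using (∃; _×_; _,_; proj₁; proj₂)
open import Data.Product.Properties using (,-injectiveʳ) renaming (≡-dec to ×-≡-dec)
open import Data.Rational as ℚ using (ℚ; 0ℚ; _/_; toℚᵘ)
import Data.Rational.Properties as ℚ
open import Data.Rational.Solver using (module +-*-Solver)
import Data.Rational.Unnormalised as ℚᵘ
import Data.Rational.Unnormalised.Properties as ℚᵘ
open import Data.Sum using (_⊎_; inj₁; inj₂)
open import Data.Vec using (Vec; []; _∷_; here; there; tabulate) renaming (lookup to lookupᵛ)
open import Data.Vec.Properties using ([]=⇒lookup; lookup⇒[]=; lookup∘tabulate; ∷-injectiveʳ; ∷-injectiveˡ)
open import Function using (_∘_; mk⇔)
open import Relation.Binary.Definitions using (DecidableEquality)
open import Relation.Binary.PropositionalEquality using (_≡_; _≢_; refl; sym; trans; cong; cong₂; subst; module ≡-Reasoning)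
open import Relation.Nullary using (Dec; yes; no; contradiction; does)
open import Relation.Nullary.Decidable using (map′; _×-dec_; dec-true)

private variable
  A : Set

-- Lists and subsets

lookup-injective : {xs : List A} → Unique xs → ∀ {i j} → lookup xs i ≡ lookup xs j → i ≡ j
lookup-injective (_  ∷ _)  {zero}  {zero}  _  = refl
lookup-injective (x∉ ∷ _)  {zero}  {suc j} eq = contradiction eq (lookupᴬ x∉ (∈-lookup j))
lookup-injective (x∉ ∷ _)  {suc i} {zero}  eq = contradiction (sym eq) (lookupᴬ x∉ (∈-lookup i))
lookup-injective (_  ∷ xs) {suc i} {suc j} eq = cong suc (lookup-injective xs eq)

none one : List Bool → Bool
none []           = true
none (true  ∷ bs) = false
none (false ∷ bs) = none bs
one []            = false
one (true  ∷ bs)  = none bs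
one (false ∷ bs)  = one bs

none⁻ : ∀ (φ : A → Bool) xs → none (map φ xs) ≡ true → ∀ {x} → x ∈ˡ xs → φ x ≢ true
none⁻ φ (x ∷ xs) h (here refl) φx rewrite φx with () ← h
none⁻ φ (x ∷ xs) h (there y∈) with false ← φ x = none⁻ φ xs h y∈

none⁺ : ∀ (φ : A → Bool) xs → (∀ {x} → x ∈ˡ xs → φ x ≢ true) → none (map φ xs) ≡ true
none⁺ φ []       h = refl
none⁺ φ (x ∷ xs) h with φ x in eq
... | true  = contradiction eq (h (here refl))
... | false = none⁺ φ xs (h ∘ there)

one⁻ : ∀ (φ : A → Bool) xs → one (map φ xs) ≡ true →
       ∃ λ x → x ∈ˡ xs × φ x ≡ true × (∀ {y} → y ∈ˡ xs → φ y ≡ true → x ≡ y)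
one⁻ φ (x ∷ xs) h with φ x in eq
... | true  = x , here refl , eq , λ where
  (here refl) _  → refl
  (there y∈)  φy → contradiction φy (none⁻ φ xs h y∈)
... | false with y , y∈ , φy , only ← one⁻ φ xs h = y , there y∈ , φy , λ where
  (here refl) φx → contradiction (trans (sym φx) eq) λ ()
  (there z∈)  φz → only z∈ φz

one⁺ : ∀ (φ : A → Bool) {xs} → Unique xs → ∀ {x} → x ∈ˡ xs → φ x ≡ true →
       (∀ {y} → y ∈ˡ xs → φ y ≡ true → x ≡ y) → one (map φ xs) ≡ true
one⁺ φ {y ∷ xs} (y∉ ∷ xs!) x∈ φx only with φ y in eq
... | true  with refl ← only (here refl) eq =
  none⁺ φ xs λ z∈ φz → lookupᴬ y∉ z∈ (only (there z∈) φz)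
one⁺ φ {y ∷ xs} (y∉ ∷ xs!) (here refl) φx only | false = contradiction (trans (sym φx) eq) λ ()
one⁺ φ {y ∷ xs} (y∉ ∷ xs!) (there x∈)  φx only | false = one⁺ φ xs! x∈ φx (only ∘ there)

length-mono : ∀ {xs ys : List A} → Unique xs → (∀ {x} → x ∈ˡ xs → x ∈ˡ ys) → length xs ≤ length ys
length-mono []                    xs⊆ys = z≤n
length-mono {xs = x ∷ xs} (x∉ ∷ xs!) xs⊆ys with as , bs , refl ← ∈-∃++ (xs⊆ys (here refl)) =
  ≤-trans (s≤s (length-mono xs! within)) (≤-reflexive (begin
    suc (length (as ++ bs))       ≡⟨ cong suc (length-++ as) ⟩
    suc (length as +ⁿ length bs)  ≡⟨ +-suc (length as) (length bs) ⟨
    length as +ⁿ suc (length bs)  ≡⟨ length-++ as ⟨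
    length (as ++ x ∷ bs)         ∎))
  where
  open ≡-Reasoning
  within : ∀ {y} → y ∈ˡ xs → y ∈ˡ as ++ bs
  within y∈ with ∈-++⁻ as (xs⊆ys (there y∈))
  ... | inj₁ y∈as          = ∈-++⁺ˡ y∈as
  ... | inj₂ (here refl)   = contradiction refl (lookupᴬ x∉ y∈)
  ... | inj₂ (there y∈bs)  = ∈-++⁺ʳ as y∈bs

elements : ∀ {m} → Subset m → List (Fin m)
elements []            = []
elements (outside ∷ p) = map suc (elements p)
elements (inside  ∷ p) = zero ∷ map suc (elements p)

length-elements : ∀ {m} (p : Subset m) → length (elements p) ≡ ∣ p ∣
length-elements []            = refl
length-elements (outside ∷ p) = trans (length-map suc (elements p)) (length-elements p)
length-elements (inside  ∷ p) = cong suc (trans (length-map suc (elements p)) (length-elements p))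

elements-unique : ∀ {m} (p : Subset m) → Unique (elements p)
elements-unique []            = []
elements-unique (outside ∷ p) = Unique.map⁺ sucᶠ-injective (elements-unique p)
elements-unique (inside  ∷ p) =
  All.map⁺ (tabulateᴬ λ _ ()) ∷ Unique.map⁺ sucᶠ-injective (elements-unique p)

∈-elements⁺ : ∀ {m} {p : Subset m} {x} → x ∈ p → x ∈ˡ elements p
∈-elements⁺ {p = inside  ∷ p} here      = here refl
∈-elements⁺ {p = inside  ∷ p} (there h) = there (∈-map⁺ suc (∈-elements⁺ h))
∈-elements⁺ {p = outside ∷ p} (there h) = ∈-map⁺ suc (∈-elements⁺ h)

∈-elements⁻ : ∀ {m} (p : Subset m) {x} → x ∈ˡ elements p → x ∈ p
∈-elements⁻ (inside  ∷ p) (here refl) = here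
∈-elements⁻ (inside  ∷ p) (there h) with _ , h , refl ← ∈-map⁻ suc h = there (∈-elements⁻ p h)
∈-elements⁻ (outside ∷ p) h         with _ , h , refl ← ∈-map⁻ suc h = there (∈-elements⁻ p h)

length-concat-applyUpTo : ∀ (f : ℕ → List A) n → length (concat (applyUpTo f n)) ≡ sum (applyUpTo (length ∘ f) n)
length-concat-applyUpTo f zero    = refl
length-concat-applyUpTo f (suc n) =
  trans (length-++ (f 0)) (cong (length (f 0) +ⁿ_) (length-concat-applyUpTo (f ∘ suc) n))

applyUpTo-cong : ∀ {f h : ℕ → A} → (∀ i → f i ≡ h i) → ∀ n → applyUpTo f n ≡ applyUpTo h n
applyUpTo-cong eq zero    = refl
applyUpTo-cong eq (suc n) = cong₂ _∷_ (eq 0) (applyUpTo-cong (eq ∘ suc) n)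

-- Names for the vertices and edges of H n

data Side : Set where
  top bot : Side

data VKind : Set where
  p₁ p₂ p₃ q₁ q₂ q₃ : VKind

data VName : Set where
  port : ℕ → Side → VName
  node : ℕ → Side → VKind → VName

-- The edges of one side: i₁, i₂ run along the row, o₁, o₂ along the outer
-- border of s₁ or s₂, v₁, v₂ join the two, and ℓ, ρ lead to the ports on
-- the left and on the right.
data EKind : Set where
  i₁ i₂ o₁ o₂ v₁ v₂ ℓ ρ : EKind

data EName : Set where
  vert mid : ℕ → EName
  edge     : ℕ → Side → EKind → EName

src tgt : EName → VName
src (vert i)        = port i bot
src (mid i)         = node i bot p₂
src (edge i s i₁)   = node i s p₁
src (edge i s i₂)   = node i s p₂
src (edge i s o₁)   = node i s q₁
src (edge i s o₂)   = node i s q₂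
src (edge i top v₁) = node i top p₁
src (edge i bot v₁) = node i bot q₁
src (edge i top v₂) = node i top p₃
src (edge i bot v₂) = node i bot q₃
src (edge i s ℓ)    = port i s
src (edge i s ρ)    = node i s p₃
tgt (vert i)        = port i top
tgt (mid i)         = node i top p₂
tgt (edge i s i₁)   = node i s p₂
tgt (edge i s i₂)   = node i s p₃
tgt (edge i s o₁)   = node i s q₂
tgt (edge i s o₂)   = node i s q₃
tgt (edge i top v₁) = node i top q₁
tgt (edge i bot v₁) = node i bot p₁
tgt (edge i top v₂) = node i top q₃
tgt (edge i bot v₂) = node i bot p₃
tgt (edge i s ℓ)    = node i s p₁
tgt (edge i s ρ)    = port (suc i) s

inc : VName → List EName
inc (port zero s)    = vert zero ∷ edge zero s ℓ ∷ []
inc (port (suc i) s) = vert (suc i) ∷ edge (suc i) s ℓ ∷ edge i s ρ ∷ []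
inc (node i s p₁)    = edge i s ℓ ∷ edge i s i₁ ∷ edge i s v₁ ∷ []
inc (node i s p₂)    = edge i s i₁ ∷ edge i s i₂ ∷ mid i ∷ []
inc (node i s p₃)    = edge i s i₂ ∷ edge i s v₂ ∷ edge i s ρ ∷ []
inc (node i s q₁)    = edge i s v₁ ∷ edge i s o₁ ∷ []
inc (node i s q₂)    = edge i s o₁ ∷ edge i s o₂ ∷ []
inc (node i s q₃)    = edge i s o₂ ∷ edge i s v₂ ∷ []

pattern 1st = here refl
pattern 2nd = there (here refl)
pattern 3rd = there (there (here refl))

inc-port-vert : ∀ i s → vert i ∈ˡ inc (port i s)
inc-port-vert zero    s = 1st
inc-port-vert (suc i) s = 1st

inc-port-ℓ : ∀ i s → edge i s ℓ ∈ˡ inc (port i s)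
inc-port-ℓ zero    s = 2nd
inc-port-ℓ (suc i) s = 2nd

inc-src : ∀ e → e ∈ˡ inc (src e)
inc-src (vert i)        = inc-port-vert i bot
inc-src (mid i)         = 3rd
inc-src (edge i s i₁)   = 2nd
inc-src (edge i s i₂)   = 2nd
inc-src (edge i s o₁)   = 2nd
inc-src (edge i s o₂)   = 2nd
inc-src (edge i top v₁) = 3rd
inc-src (edge i bot v₁) = 1st
inc-src (edge i top v₂) = 2nd
inc-src (edge i bot v₂) = 2nd
inc-src (edge i s ℓ)    = inc-port-ℓ i s
inc-src (edge i s ρ)    = 3rd

inc-tgt : ∀ e → e ∈ˡ inc (tgt e)
inc-tgt (vert i)        = inc-port-vert i top
inc-tgt (mid i)         = 3rd
inc-tgt (edge i s i₁)   = 1st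
inc-tgt (edge i s i₂)   = 1st
inc-tgt (edge i s o₁)   = 1st
inc-tgt (edge i s o₂)   = 1st
inc-tgt (edge i top v₁) = 1st
inc-tgt (edge i bot v₁) = 3rd
inc-tgt (edge i top v₂) = 2nd
inc-tgt (edge i bot v₂) = 2nd
inc-tgt (edge i s ℓ)    = 1st
inc-tgt (edge i s ρ)    = 3rd

IncidentTo : VName → EName → Set
IncidentTo v e = v ≡ src e ⊎ v ≡ tgt e

inc-complete : ∀ {v} e → IncidentTo v e → e ∈ˡ inc v
inc-complete e (inj₁ refl) = inc-src e
inc-complete e (inj₂ refl) = inc-tgt e

inc-sound : ∀ v → All (IncidentTo v) (inc v)
inc-sound (port zero top)    = inj₂ refl ∷ inj₁ refl ∷ []
inc-sound (port zero bot)    = inj₁ refl ∷ inj₁ refl ∷ []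
inc-sound (port (suc i) top) = inj₂ refl ∷ inj₁ refl ∷ inj₂ refl ∷ []
inc-sound (port (suc i) bot) = inj₁ refl ∷ inj₁ refl ∷ inj₂ refl ∷ []
inc-sound (node i top p₁)    = inj₂ refl ∷ inj₁ refl ∷ inj₁ refl ∷ []
inc-sound (node i bot p₁)    = inj₂ refl ∷ inj₁ refl ∷ inj₂ refl ∷ []
inc-sound (node i top p₂)    = inj₂ refl ∷ inj₁ refl ∷ inj₂ refl ∷ []
inc-sound (node i bot p₂)    = inj₂ refl ∷ inj₁ refl ∷ inj₁ refl ∷ []
inc-sound (node i top p₃)    = inj₂ refl ∷ inj₁ refl ∷ inj₁ refl ∷ []
inc-sound (node i bot p₃)    = inj₂ refl ∷ inj₂ refl ∷ inj₁ refl ∷ []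
inc-sound (node i top q₁)    = inj₂ refl ∷ inj₁ refl ∷ []
inc-sound (node i bot q₁)    = inj₁ refl ∷ inj₁ refl ∷ []
inc-sound (node i s q₂)      = inj₂ refl ∷ inj₁ refl ∷ []
inc-sound (node i top q₃)    = inj₂ refl ∷ inj₂ refl ∷ []
inc-sound (node i bot q₃)    = inj₂ refl ∷ inj₁ refl ∷ []

inc-unique : ∀ v → Unique (inc v)
inc-unique (port zero s)    = ((λ ()) ∷ []) ∷ [] ∷ []
inc-unique (port (suc i) s) = ((λ ()) ∷ (λ ()) ∷ []) ∷ ((λ ()) ∷ []) ∷ [] ∷ []
inc-unique (node i s p₁)    = ((λ ()) ∷ (λ ()) ∷ []) ∷ ((λ ()) ∷ []) ∷ [] ∷ []
inc-unique (node i s p₂)    = ((λ ()) ∷ (λ ()) ∷ []) ∷ ((λ ()) ∷ []) ∷ [] ∷ []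
inc-unique (node i s p₃)    = ((λ ()) ∷ (λ ()) ∷ []) ∷ ((λ ()) ∷ []) ∷ [] ∷ []
inc-unique (node i s q₁)    = ((λ ()) ∷ []) ∷ [] ∷ []
inc-unique (node i s q₂)    = ((λ ()) ∷ []) ∷ [] ∷ []
inc-unique (node i s q₃)    = ((λ ()) ∷ []) ∷ [] ∷ []

-- 4 * i in the form for which 4 * (1 + i) computes to 4 + 4 * i.
4×_ : ℕ → ℕ
4× zero  = 0
4× suc i = 4 +ⁿ (4× i)

4×-correct : ∀ i → 4 *ⁿ i ≡ 4× i
4×-correct zero    = refl
4×-correct (suc i) = trans (*-suc 4 i) (cong (4 +ⁿ_) (4×-correct i))

column : VKind → ℕ
column p₁ = 1
column p₂ = 2
column p₃ = 3
column q₁ = 1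
column q₂ = 2
column q₃ = 3

row : Side → VKind → ℕ
row top p₁ = 2
row top p₂ = 2
row top p₃ = 2
row top q₁ = 3
row top q₂ = 3
row top q₃ = 3
row bot p₁ = 1
row bot p₂ = 1
row bot p₃ = 1
row bot q₁ = 0
row bot q₂ = 0
row bot q₃ = 0

point : VName → Point
point (port i top) = 4× i , 2
point (port i bot) = 4× i , 1
point (node i s k) = column k +ⁿ (4× i) , row s k

ends : EName → Point × Point
ends e = point (src e) , point (tgt e)

divMod4 : ℕ → ℕ × ℕ
divMod4 (suc (suc (suc (suc x)))) = let i , k = divMod4 x in suc i , k
divMod4 x                         = 0 , x

divMod4-4× : ∀ (k : Fin 4) i → divMod4 (toℕ k +ⁿ (4× i)) ≡ (i , toℕ k)
divMod4-4× 0F zero    = refl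
divMod4-4× 1F zero    = refl
divMod4-4× 2F zero    = refl
divMod4-4× 3F zero    = refl
divMod4-4× 0F (suc i) rewrite divMod4-4× 0F i = refl
divMod4-4× 1F (suc i) rewrite divMod4-4× 1F i = refl
divMod4-4× 2F (suc i) rewrite divMod4-4× 2F i = refl
divMod4-4× 3F (suc i) rewrite divMod4-4× 3F i = refl

vertexAt : ℕ × ℕ → ℕ → Maybe VName
vertexAt (i , 0) 1 = just (port i bot)
vertexAt (i , 0) 2 = just (port i top)
vertexAt (i , 1) 0 = just (node i bot q₁)
vertexAt (i , 1) 1 = just (node i bot p₁)
vertexAt (i , 1) 2 = just (node i top p₁)
vertexAt (i , 1) 3 = just (node i top q₁)
vertexAt (i , 2) 0 = just (node i bot q₂)
vertexAt (i , 2) 1 = just (node i bot p₂)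
vertexAt (i , 2) 2 = just (node i top p₂)
vertexAt (i , 2) 3 = just (node i top q₂)
vertexAt (i , 3) 0 = just (node i bot q₃)
vertexAt (i , 3) 1 = just (node i bot p₃)
vertexAt (i , 3) 2 = just (node i top p₃)
vertexAt (i , 3) 3 = just (node i top q₃)
vertexAt _       _ = nothing

vertexAt-point : ∀ v → vertexAt (divMod4 (proj₁ (point v))) (proj₂ (point v)) ≡ just v
vertexAt-point (port i top)    rewrite divMod4-4× 0F i = refl
vertexAt-point (port i bot)    rewrite divMod4-4× 0F i = refl
vertexAt-point (node i top p₁) rewrite divMod4-4× 1F i = refl
vertexAt-point (node i top p₂) rewrite divMod4-4× 2F i = refl
vertexAt-point (node i top p₃) rewrite divMod4-4× 3F i = refl
vertexAt-point (node i top q₁) rewrite divMod4-4× 1F i = refl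
vertexAt-point (node i top q₂) rewrite divMod4-4× 2F i = refl
vertexAt-point (node i top q₃) rewrite divMod4-4× 3F i = refl
vertexAt-point (node i bot p₁) rewrite divMod4-4× 1F i = refl
vertexAt-point (node i bot p₂) rewrite divMod4-4× 2F i = refl
vertexAt-point (node i bot p₃) rewrite divMod4-4× 3F i = refl
vertexAt-point (node i bot q₁) rewrite divMod4-4× 1F i = refl
vertexAt-point (node i bot q₂) rewrite divMod4-4× 2F i = refl
vertexAt-point (node i bot q₃) rewrite divMod4-4× 3F i = refl

point-injective : ∀ {u v} → point u ≡ point v → u ≡ v
point-injective {u} {v} eq = just-injective (trans (sym (vertexAt-point u))
  (trans (cong (λ (x , y) → vertexAt (divMod4 x) y) eq) (vertexAt-point v)))

edgeBetween : VName → VName → Maybe EName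
edgeBetween (port i _)    (port _ _)    = just (vert i)
edgeBetween (port i s)    (node _ _ _)  = just (edge i s ℓ)
edgeBetween (node i s _)  (port _ _)    = just (edge i s ρ)
edgeBetween (node i bot p₂) (node _ top p₂) = just (mid i)
edgeBetween (node i s p₁) (node _ _ p₂) = just (edge i s i₁)
edgeBetween (node i s p₂) (node _ _ p₃) = just (edge i s i₂)
edgeBetween (node i s q₁) (node _ _ q₂) = just (edge i s o₁)
edgeBetween (node i s q₂) (node _ _ q₃) = just (edge i s o₂)
edgeBetween (node i s p₁) (node _ _ q₁) = just (edge i s v₁)
edgeBetween (node i s q₁) (node _ _ p₁) = just (edge i s v₁)
edgeBetween (node i s p₃) (node _ _ q₃) = just (edge i s v₂)
edgeBetween (node i s q₃) (node _ _ p₃) = just (edge i s v₂)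
edgeBetween _             _             = nothing

edgeBetween-ends : ∀ e → edgeBetween (src e) (tgt e) ≡ just e
edgeBetween-ends (vert i)        = refl
edgeBetween-ends (mid i)         = refl
edgeBetween-ends (edge i top i₁) = refl
edgeBetween-ends (edge i bot i₁) = refl
edgeBetween-ends (edge i top i₂) = refl
edgeBetween-ends (edge i bot i₂) = refl
edgeBetween-ends (edge i top o₁) = refl
edgeBetween-ends (edge i bot o₁) = refl
edgeBetween-ends (edge i top o₂) = refl
edgeBetween-ends (edge i bot o₂) = refl
edgeBetween-ends (edge i top v₁) = refl
edgeBetween-ends (edge i bot v₁) = refl
edgeBetween-ends (edge i top v₂) = refl
edgeBetween-ends (edge i bot v₂) = refl
edgeBetween-ends (edge i top ℓ)  = refl
edgeBetween-ends (edge i bot ℓ)  = refl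
edgeBetween-ends (edge i top ρ)  = refl
edgeBetween-ends (edge i bot ρ)  = refl

ends-injective : ∀ {e f} → ends e ≡ ends f → e ≡ f
ends-injective {e} {f} eq = just-injective (trans (sym (edgeBetween-ends e))
  (trans (cong₂ edgeBetween (point-injective (cong proj₁ eq)) (point-injective (cong proj₂ eq)))
         (edgeBetween-ends f)))

_≟ᵉ_ : DecidableEquality EName
e ≟ᵉ f = map′ ends-injective (cong ends) (×-≡-dec _≟ᵖ_ _≟ᵖ_ (ends e) (ends f))

open DecMembership _≟ᵉ_ using () renaming (_∈?_ to _∈ˡ?_)

edgesOf : ℕ → List EName
edgesOf i =
  edge i bot ℓ ∷ edge i bot i₁ ∷ edge i top ℓ ∷ edge i top i₁ ∷ vert i ∷ mid i ∷
  edge i bot i₂ ∷ edge i bot ρ ∷ edge i top i₂ ∷ edge i top ρ ∷ mid i ∷ vert (suc i) ∷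
  edge i top i₁ ∷ edge i top i₂ ∷ edge i top o₁ ∷ edge i top o₂ ∷ edge i top v₁ ∷ edge i top v₂ ∷
  edge i bot o₁ ∷ edge i bot o₂ ∷ edge i bot i₁ ∷ edge i bot i₂ ∷ edge i bot v₁ ∷ edge i bot v₂ ∷ []

verticesOf : ℕ → List VName
verticesOf i =
  port i bot ∷ node i bot p₁ ∷ node i bot p₂ ∷ port i top ∷ node i top p₁ ∷ node i top p₂ ∷
  node i bot p₂ ∷ node i bot p₃ ∷ port (suc i) bot ∷ node i top p₂ ∷ node i top p₃ ∷ port (suc i) top ∷
  node i top p₁ ∷ node i top p₂ ∷ node i top p₃ ∷ node i top q₁ ∷ node i top q₂ ∷ node i top q₃ ∷
  node i bot q₁ ∷ node i bot q₂ ∷ node i bot q₃ ∷ node i bot p₁ ∷ node i bot p₂ ∷ node i bot p₃ ∷ []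

concatMap-hexEdges-pyrene : ∀ i → concatMap hexEdges (pyrene i) ≡ map ends (edgesOf i)
concatMap-hexEdges-pyrene i rewrite 4×-correct i = refl

concatMap-hexVertices-pyrene : ∀ i → concatMap hexVertices (pyrene i) ≡ map point (verticesOf i)
concatMap-hexVertices-pyrene i rewrite 4×-correct i = refl

-- vert i and port i occur in H n for i ≤ n, except when n = 0.
ValidE : ℕ → EName → Set
ValidE n (vert zero)    = 0 < n
ValidE n (vert (suc i)) = i < n
ValidE n (mid i)        = i < n
ValidE n (edge i s k)   = i < n

ValidV : ℕ → VName → Set
ValidV n (port zero s)    = 0 < n
ValidV n (port (suc i) s) = i < n
ValidV n (node i s k)     = i < n

vert-valid : ∀ {n i} → i < n → ValidE n (vert i)
vert-valid {i = zero}  h = h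
vert-valid {i = suc i} h = <⇒≤ h

port-valid : ∀ {n i s} → i < n → ValidV n (port i s)
port-valid {i = zero}  h = h
port-valid {i = suc i} h = <⇒≤ h

edgesOf-valid : ∀ {n i} → i < n → All (ValidE n) (edgesOf i)
edgesOf-valid {n} {i} h =
  h ∷ h ∷ h ∷ h ∷ vert-valid h ∷ h ∷ h ∷ h ∷ h ∷ h ∷ h ∷ h ∷
  h ∷ h ∷ h ∷ h ∷ h ∷ h ∷ h ∷ h ∷ h ∷ h ∷ h ∷ h ∷ []

verticesOf-valid : ∀ {n i} → i < n → All (ValidV n) (verticesOf i)
verticesOf-valid {n} {i} h =
  port-valid {s = bot} h ∷ h ∷ h ∷ port-valid {s = top} h ∷ h ∷ h ∷ h ∷ h ∷ h ∷ h ∷ h ∷ h ∷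
  h ∷ h ∷ h ∷ h ∷ h ∷ h ∷ h ∷ h ∷ h ∷ h ∷ h ∷ h ∷ []

valid-edgesOf : ∀ {n} e → ValidE n e → ∃ λ i → i < n × e ∈ˡ edgesOf i
valid-edgesOf (vert zero)     h = _ , h , ∈-lookup {xs = edgesOf _} (#ᶠ 4)
valid-edgesOf (vert (suc i))  h = _ , h , ∈-lookup {xs = edgesOf _} (#ᶠ 11)
valid-edgesOf (mid i)         h = _ , h , ∈-lookup {xs = edgesOf _} (#ᶠ 5)
valid-edgesOf (edge i bot ℓ)  h = _ , h , ∈-lookup {xs = edgesOf _} (#ᶠ 0)
valid-edgesOf (edge i bot i₁) h = _ , h , ∈-lookup {xs = edgesOf _} (#ᶠ 1)
valid-edgesOf (edge i top ℓ)  h = _ , h , ∈-lookup {xs = edgesOf _} (#ᶠ 2)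
valid-edgesOf (edge i top i₁) h = _ , h , ∈-lookup {xs = edgesOf _} (#ᶠ 3)
valid-edgesOf (edge i bot i₂) h = _ , h , ∈-lookup {xs = edgesOf _} (#ᶠ 6)
valid-edgesOf (edge i bot ρ)  h = _ , h , ∈-lookup {xs = edgesOf _} (#ᶠ 7)
valid-edgesOf (edge i top i₂) h = _ , h , ∈-lookup {xs = edgesOf _} (#ᶠ 8)
valid-edgesOf (edge i top ρ)  h = _ , h , ∈-lookup {xs = edgesOf _} (#ᶠ 9)
valid-edgesOf (edge i top o₁) h = _ , h , ∈-lookup {xs = edgesOf _} (#ᶠ 14)
valid-edgesOf (edge i top o₂) h = _ , h , ∈-lookup {xs = edgesOf _} (#ᶠ 15)
valid-edgesOf (edge i top v₁) h = _ , h , ∈-lookup {xs = edgesOf _} (#ᶠ 16)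
valid-edgesOf (edge i top v₂) h = _ , h , ∈-lookup {xs = edgesOf _} (#ᶠ 17)
valid-edgesOf (edge i bot o₁) h = _ , h , ∈-lookup {xs = edgesOf _} (#ᶠ 18)
valid-edgesOf (edge i bot o₂) h = _ , h , ∈-lookup {xs = edgesOf _} (#ᶠ 19)
valid-edgesOf (edge i bot v₁) h = _ , h , ∈-lookup {xs = edgesOf _} (#ᶠ 22)
valid-edgesOf (edge i bot v₂) h = _ , h , ∈-lookup {xs = edgesOf _} (#ᶠ 23)

valid-verticesOf : ∀ {n} v → ValidV n v → ∃ λ i → i < n × v ∈ˡ verticesOf i
valid-verticesOf (port zero bot)    h = _ , h , ∈-lookup {xs = verticesOf _} (#ᶠ 0)
valid-verticesOf (port zero top)    h = _ , h , ∈-lookup {xs = verticesOf _} (#ᶠ 3)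
valid-verticesOf (port (suc i) bot) h = _ , h , ∈-lookup {xs = verticesOf _} (#ᶠ 8)
valid-verticesOf (port (suc i) top) h = _ , h , ∈-lookup {xs = verticesOf _} (#ᶠ 11)
valid-verticesOf (node i top p₁)    h = _ , h , ∈-lookup {xs = verticesOf _} (#ᶠ 12)
valid-verticesOf (node i top p₂)    h = _ , h , ∈-lookup {xs = verticesOf _} (#ᶠ 13)
valid-verticesOf (node i top p₃)    h = _ , h , ∈-lookup {xs = verticesOf _} (#ᶠ 14)
valid-verticesOf (node i top q₁)    h = _ , h , ∈-lookup {xs = verticesOf _} (#ᶠ 15)
valid-verticesOf (node i top q₂)    h = _ , h , ∈-lookup {xs = verticesOf _} (#ᶠ 16)
valid-verticesOf (node i top q₃)    h = _ , h , ∈-lookup {xs = verticesOf _} (#ᶠ 17)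
valid-verticesOf (node i bot q₁)    h = _ , h , ∈-lookup {xs = verticesOf _} (#ᶠ 18)
valid-verticesOf (node i bot q₂)    h = _ , h , ∈-lookup {xs = verticesOf _} (#ᶠ 19)
valid-verticesOf (node i bot q₃)    h = _ , h , ∈-lookup {xs = verticesOf _} (#ᶠ 20)
valid-verticesOf (node i bot p₁)    h = _ , h , ∈-lookup {xs = verticesOf _} (#ᶠ 21)
valid-verticesOf (node i bot p₂)    h = _ , h , ∈-lookup {xs = verticesOf _} (#ᶠ 22)
valid-verticesOf (node i bot p₃)    h = _ , h , ∈-lookup {xs = verticesOf _} (#ᶠ 23)

∈-pyrenes⁻ : ∀ (f : Point → List A) n {y} → y ∈ˡ concatMap f (concatMap pyrene (downFrom n)) →
             ∃ λ i → i < n × y ∈ˡ concatMap f (pyrene i)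
∈-pyrenes⁻ f n y∈ =
  let h , h∈ , y∈h = find (∈-concatMap⁻ f {xs = concatMap pyrene (downFrom n)} y∈)
      i , i∈ , h∈i = find (∈-concatMap⁻ pyrene {xs = downFrom n} h∈)
  in i , ∈-downFrom⁻ i∈ , ∈-concatMap⁺ f (lose h∈i y∈h)

∈-pyrenes⁺ : ∀ (f : Point → List A) {n i y} → i < n → y ∈ˡ concatMap f (pyrene i) →
             y ∈ˡ concatMap f (concatMap pyrene (downFrom n))
∈-pyrenes⁺ f {i = i} i<n y∈ =
  let h , h∈ , y∈h = find (∈-concatMap⁻ f {xs = pyrene i} y∈)
  in ∈-concatMap⁺ f (lose (∈-concatMap⁺ pyrene (lose (∈-downFrom⁺ i<n) h∈)) y∈h)

∈-edges⁻ : ∀ n {p} → p ∈ˡ Graph.edges (H n) → ∃ λ e → ValidE n e × p ≡ ends e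
∈-edges⁻ n {p} p∈
  with i , i<n , p∈i ← ∈-pyrenes⁻ hexEdges n (∈-deduplicate⁻ (×-≡-dec _≟ᵖ_ _≟ᵖ_) _ p∈)
  with e , e∈ , eq ← ∈-map⁻ ends (subst (p ∈ˡ_) (concatMap-hexEdges-pyrene i) p∈i)
  = e , lookupᴬ (edgesOf-valid i<n) e∈ , eq

∈-edges⁺ : ∀ n {e} → ValidE n e → ends e ∈ˡ Graph.edges (H n)
∈-edges⁺ n {e} v with i , i<n , e∈ ← valid-edgesOf e v =
  ∈-deduplicate⁺ (×-≡-dec _≟ᵖ_ _≟ᵖ_) (∈-pyrenes⁺ hexEdges i<n
    (subst (ends e ∈ˡ_) (sym (concatMap-hexEdges-pyrene i)) (∈-map⁺ ends e∈)))

∈-vertices⁻ : ∀ n {p} → p ∈ˡ Graph.vertices (H n) → ∃ λ v → ValidV n v × p ≡ point v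
∈-vertices⁻ n {p} p∈
  with i , i<n , p∈i ← ∈-pyrenes⁻ hexVertices n (∈-deduplicate⁻ _≟ᵖ_ _ p∈)
  with v , v∈ , eq ← ∈-map⁻ point (subst (p ∈ˡ_) (concatMap-hexVertices-pyrene i) p∈i)
  = v , lookupᴬ (verticesOf-valid i<n) v∈ , eq

∈-vertices⁺ : ∀ n {v} → ValidV n v → point v ∈ˡ Graph.vertices (H n)
∈-vertices⁺ n {v} h with i , i<n , v∈ ← valid-verticesOf v h =
  ∈-deduplicate⁺ _≟ᵖ_ (∈-pyrenes⁺ hexVertices i<n
    (subst (point v ∈ˡ_) (sym (concatMap-hexVertices-pyrene i)) (∈-map⁺ point v∈)))

-- H n is accessed only through this record, so that its deduplicated edge list
-- is never unfolded.
record IsPyreneSystem (n : ℕ) (vertices : List Point) (edges : List (Point × Point)) : Set where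
  field
    edges-unique : Unique edges
    edges⁻    : ∀ {p} → p ∈ˡ edges → ∃ λ e → ValidE n e × p ≡ ends e
    edges⁺    : ∀ {e} → ValidE n e → ends e ∈ˡ edges
    vertices⁻ : ∀ {p} → p ∈ˡ vertices → ∃ λ v → ValidV n v × p ≡ point v
    vertices⁺ : ∀ {v} → ValidV n v → point v ∈ˡ vertices

H-isPyreneSystem : ∀ n → IsPyreneSystem n (Graph.vertices (H n)) (Graph.edges (H n))
H-isPyreneSystem n = record
  { edges-unique = deduplicate-! (×-≡-dec _≟ᵖ_ _≟ᵖ_) _
  ; edges⁻       = ∈-edges⁻ n
  ; edges⁺       = ∈-edges⁺ n
  ; vertices⁻    = ∈-vertices⁻ n
  ; vertices⁺    = ∈-vertices⁺ n
  }

-- Perfect matchings as words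

Covered : (EName → Bool) → VName → Set
Covered φ v = one (map φ (inc v)) ≡ true

data Dir : Set where
  L R : Dir

-- How a perfect matching restricts to one side of a pyrene fragment: s₁ (or
-- s₂) is an alternating hexagon in one of its two states, or the side is
-- matched to its left or right port.
data State : Set where
  dir       : Dir → State
  portˡ portʳ : State

uses : State → EKind → Bool
uses (dir L) i₁ = true
uses (dir L) o₁ = true
uses (dir L) v₂ = true
uses (dir L) _  = false
uses (dir R) i₂ = true
uses (dir R) v₁ = true
uses (dir R) o₂ = true
uses (dir R) _  = false
uses portˡ   ℓ  = true
uses portˡ   o₁ = true
uses portˡ   v₂ = true
uses portˡ   _  = false
uses portʳ   ρ  = true
uses portʳ   v₁ = true
uses portʳ   o₂ = true
uses portʳ   _  = false

usesMid : State → Bool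
usesMid (dir _) = false
usesMid portˡ   = true
usesMid portʳ   = true

data Fragment : Set where
  both    : Dir → Dir → Fragment
  inˡ inʳ : Fragment

state : Fragment → Side → State
state (both x y) top = dir x
state (both x y) bot = dir y
state inˡ        _   = portˡ
state inʳ        _   = portʳ

isˡ isʳ isMid : Fragment → Bool
isˡ (both _ _) = false
isˡ inˡ        = true
isˡ inʳ        = false
isʳ (both _ _) = false
isʳ inˡ        = false
isʳ inʳ        = true
isMid (both _ _) = false
isMid inˡ        = true
isMid inʳ        = true

usesMid-state : ∀ t s → usesMid (state t s) ≡ isMid t
usesMid-state (both x y) top = refl
usesMid-state (both x y) bot = refl
usesMid-state inˡ        s   = refl
usesMid-state inʳ        s   = refl

uses-ℓ : ∀ t s → uses (state t s) ℓ ≡ isˡ t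
uses-ℓ (both L y) top = refl
uses-ℓ (both R y) top = refl
uses-ℓ (both x L) bot = refl
uses-ℓ (both x R) bot = refl
uses-ℓ inˡ        s   = refl
uses-ℓ inʳ        s   = refl

uses-ρ : ∀ t s → uses (state t s) ρ ≡ isʳ t
uses-ρ (both L y) top = refl
uses-ρ (both R y) top = refl
uses-ρ (both x L) bot = refl
uses-ρ (both x R) bot = refl
uses-ρ inˡ        s   = refl
uses-ρ inʳ        s   = refl

isˡ⇒≡ : ∀ {t} → isˡ t ≡ true → t ≡ inˡ
isˡ⇒≡ {inˡ} _ = refl

isʳ⇒≡ : ∀ {t} → isʳ t ≡ true → t ≡ inʳ
isʳ⇒≡ {inʳ} _ = refl

Word : Set
Word = ℕ → Fragment

afterʳ : Word → ℕ → Bool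
afterʳ g zero    = false
afterʳ g (suc i) = isʳ (g i)

matching : Word → EName → Bool
matching g (vert i)     = not (afterʳ g i ∨ isˡ (g i))
matching g (mid i)      = isMid (g i)
matching g (edge i s k) = uses (state (g i) s) k

Admissible : Word → Set
Admissible g = ∀ i → isʳ (g i) ≡ true → isˡ (g (suc i)) ≡ true → ⊥

-- both L L is used as padding: it leaves the ports alone.
EndsAt : ℕ → Word → Set
EndsAt n g = ∀ i → n ≤ i → g i ≡ both L L

adm-afterʳ : ∀ {g} → Admissible g → ∀ i → isˡ (g i) ≡ true → afterʳ g i ≡ false
adm-afterʳ adm zero    _ = refl
adm-afterʳ adm (suc i) h = ¬-not λ r → adm i r h

-- Every admissible word is a perfect matching

nodeBits : State → VKind → List Bool
nodeBits t p₁ = uses t ℓ ∷ uses t i₁ ∷ uses t v₁ ∷ []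
nodeBits t p₂ = uses t i₁ ∷ uses t i₂ ∷ usesMid t ∷ []
nodeBits t p₃ = uses t i₂ ∷ uses t v₂ ∷ uses t ρ ∷ []
nodeBits t q₁ = uses t v₁ ∷ uses t o₁ ∷ []
nodeBits t q₂ = uses t o₁ ∷ uses t o₂ ∷ []
nodeBits t q₃ = uses t o₂ ∷ uses t v₂ ∷ []

one-nodeBits : ∀ t k → one (nodeBits t k) ≡ true
one-nodeBits (dir L) p₁ = refl
one-nodeBits (dir L) p₂ = refl
one-nodeBits (dir L) p₃ = refl
one-nodeBits (dir L) q₁ = refl
one-nodeBits (dir L) q₂ = refl
one-nodeBits (dir L) q₃ = refl
one-nodeBits (dir R) p₁ = refl
one-nodeBits (dir R) p₂ = refl
one-nodeBits (dir R) p₃ = refl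
one-nodeBits (dir R) q₁ = refl
one-nodeBits (dir R) q₂ = refl
one-nodeBits (dir R) q₃ = refl
one-nodeBits portˡ   p₁ = refl
one-nodeBits portˡ   p₂ = refl
one-nodeBits portˡ   p₃ = refl
one-nodeBits portˡ   q₁ = refl
one-nodeBits portˡ   q₂ = refl
one-nodeBits portˡ   q₃ = refl
one-nodeBits portʳ   p₁ = refl
one-nodeBits portʳ   p₂ = refl
one-nodeBits portʳ   p₃ = refl
one-nodeBits portʳ   q₁ = refl
one-nodeBits portʳ   q₂ = refl
one-nodeBits portʳ   q₃ = refl

one-port₂ : ∀ l → one (not l ∷ l ∷ []) ≡ true
one-port₂ true  = refl
one-port₂ false = refl

one-port₃ : ∀ l r → (r ≡ true → l ≡ true → ⊥) → one (not (r ∨ l) ∷ l ∷ r ∷ []) ≡ true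
one-port₃ false false h = refl
one-port₃ false true  h = refl
one-port₃ true  false h = refl
one-port₃ true  true  h = ⊥-elim (h refl refl)

matching-covers : ∀ {g} → Admissible g → ∀ v → Covered (matching g) v
matching-covers {g} adm (port zero s)
  rewrite uses-ℓ (g 0) s = one-port₂ (isˡ (g 0))
matching-covers {g} adm (port (suc i) s)
  rewrite uses-ℓ (g (suc i)) s | uses-ρ (g i) s = one-port₃ (isˡ (g (suc i))) (isʳ (g i)) (adm i)
matching-covers {g} adm (node i s p₁) = one-nodeBits (state (g i) s) p₁
matching-covers {g} adm (node i s p₂)
  rewrite sym (usesMid-state (g i) s) = one-nodeBits (state (g i) s) p₂
matching-covers {g} adm (node i s p₃) = one-nodeBits (state (g i) s) p₃
matching-covers {g} adm (node i s q₁) = one-nodeBits (state (g i) s) q₁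
matching-covers {g} adm (node i s q₂) = one-nodeBits (state (g i) s) q₂
matching-covers {g} adm (node i s q₃) = one-nodeBits (state (g i) s) q₃

matching-cong : ∀ {g g′} → (∀ i → g i ≡ g′ i) → ∀ e → matching g e ≡ matching g′ e
matching-cong eq (vert zero)    = cong (λ t → not (isˡ t)) (eq 0)
matching-cong eq (vert (suc i)) = cong₂ (λ t u → not (isʳ t ∨ isˡ u)) (eq i) (eq (suc i))
matching-cong eq (mid i)        = cong isMid (eq i)
matching-cong eq (edge i s k)   = cong (λ t → uses (state t s) k) (eq i)

-- Every perfect matching is an admissible word

decode : Bool → Bool → Bool → Bool → Fragment
decode true  true  _ _ = inˡ
decode true  false _ _ = inʳ
decode false _     x y = both (turn x) (turn y)
  where
  turn : Bool → Dir
  turn true  = R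
  turn false = L

word : (EName → Bool) → Word
word φ i = decode (φ (mid i)) (φ (edge i top ℓ)) (φ (edge i top v₁)) (φ (edge i bot v₁))

word-matching : ∀ g i → word (matching g) i ≡ g i
word-matching g i with g i
... | both L L = refl
... | both L R = refl
... | both R L = refl
... | both R R = refl
... | inˡ      = refl
... | inʳ      = refl

Agrees : (EName → Bool) → ℕ → Side → State → Set
Agrees φ i s t = (∀ k → φ (edge i s k) ≡ uses t k) × φ (mid i) ≡ usesMid t

sideState : ∀ φ i s → (∀ k → Covered φ (node i s k)) → ∃ (Agrees φ i s)
sideState φ i s cov = collect (classify _ _ _ _ _ _ _ _ _ (cov q₁) (cov q₂) (cov q₃) (cov p₁) (cov p₂) (cov p₃))
  where
  Bits : (a b c d e f g h m : Bool) → State → Set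
  Bits a b c d e f g h m t =
    a ≡ uses t i₁ × b ≡ uses t i₂ × c ≡ uses t o₁ × d ≡ uses t o₂ × e ≡ uses t v₁ ×
    f ≡ uses t v₂ × g ≡ uses t ℓ × h ≡ uses t ρ × m ≡ usesMid t

  classify : ∀ e c d f g a b m h →
    one (e ∷ c ∷ []) ≡ true → one (c ∷ d ∷ []) ≡ true → one (d ∷ f ∷ []) ≡ true →
    one (g ∷ a ∷ e ∷ []) ≡ true → one (a ∷ b ∷ m ∷ []) ≡ true → one (b ∷ f ∷ h ∷ []) ≡ true →
    ∃ (Bits a b c d e f g h m)
  classify true  false true  false false false true  false false refl refl refl refl refl refl =
    dir R , refl , refl , refl , refl , refl , refl , refl , refl , refl
  classify true  false true  false false false false true  true  refl refl refl refl refl refl =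
    portʳ , refl , refl , refl , refl , refl , refl , refl , refl , refl
  classify false true  false true  false true  false false false refl refl refl refl refl refl =
    dir L , refl , refl , refl , refl , refl , refl , refl , refl , refl
  classify false true  false true  true  false false true  false refl refl refl refl refl refl =
    portˡ , refl , refl , refl , refl , refl , refl , refl , refl , refl
  classify true _ _ _ true true  _ _ _ _ _ _ () _ _
  classify true _ _ _ true false _ _ _ _ _ _ () _ _

  collect : ∃ (Bits (φ (edge i s i₁)) (φ (edge i s i₂)) (φ (edge i s o₁)) (φ (edge i s o₂))
                    (φ (edge i s v₁)) (φ (edge i s v₂)) (φ (edge i s ℓ)) (φ (edge i s ρ)) (φ (mid i))) →
            ∃ (Agrees φ i s)
  collect (t , a , b , c , d , e , f , g , h , m) = t , (λ where
    i₁ → a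
    i₂ → b
    o₁ → c
    o₂ → d
    v₁ → e
    v₂ → f
    ℓ  → g
    ρ  → h) , m

ℓ-mid⇒ρ : ∀ t u → uses t ℓ ≡ uses u ℓ → usesMid t ≡ usesMid u → uses t ρ ≡ uses u ρ
ℓ-mid⇒ρ (dir L) (dir L) _ _ = refl
ℓ-mid⇒ρ (dir L) (dir R) _ _ = refl
ℓ-mid⇒ρ (dir R) (dir L) _ _ = refl
ℓ-mid⇒ρ (dir R) (dir R) _ _ = refl
ℓ-mid⇒ρ portˡ   portˡ   _ _ = refl
ℓ-mid⇒ρ portʳ   portʳ   _ _ = refl
ℓ-mid⇒ρ (dir L) portˡ   _ ()
ℓ-mid⇒ρ (dir R) portˡ   _ ()
ℓ-mid⇒ρ (dir L) portʳ   _ ()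
ℓ-mid⇒ρ (dir R) portʳ   _ ()

onState : Side → State → State → State
onState top t u = t
onState bot t u = u

state-decode : ∀ t u s → uses t ℓ ≡ uses u ℓ → usesMid t ≡ usesMid u →
               state (decode (usesMid t) (uses t ℓ) (uses t v₁) (uses u v₁)) s ≡ onState s t u
state-decode (dir L) (dir L) top _ _ = refl
state-decode (dir L) (dir R) top _ _ = refl
state-decode (dir R) (dir L) top _ _ = refl
state-decode (dir R) (dir R) top _ _ = refl
state-decode (dir L) (dir L) bot _ _ = refl
state-decode (dir L) (dir R) bot _ _ = refl
state-decode (dir R) (dir L) bot _ _ = refl
state-decode (dir R) (dir R) bot _ _ = refl
state-decode portˡ   portˡ   top _ _ = refl
state-decode portˡ   portˡ   bot _ _ = refl
state-decode portʳ   portʳ   top _ _ = refl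
state-decode portʳ   portʳ   bot _ _ = refl
state-decode (dir L) portˡ   _   _ ()
state-decode (dir R) portˡ   _   _ ()
state-decode (dir L) portʳ   _   _ ()
state-decode (dir R) portʳ   _   _ ()

port₂-agree : ∀ v l l′ → one (v ∷ l ∷ []) ≡ true → one (v ∷ l′ ∷ []) ≡ true → l ≡ l′
port₂-agree true  false false refl refl = refl
port₂-agree false true  true  refl refl = refl

port₃-agree : ∀ v l l′ r r′ → one (v ∷ l ∷ r ∷ []) ≡ true → one (v ∷ l′ ∷ r′ ∷ []) ≡ true →
              r ≡ r′ → l ≡ l′
port₃-agree true  false false r     r′    _    _    _    = refl
port₃-agree false true  true  false false refl refl refl = refl
port₃-agree false false false true  true  refl refl refl = refl

port₂-vert : ∀ v l → one (v ∷ l ∷ []) ≡ true → v ≡ not l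
port₂-vert true  false refl = refl
port₂-vert false true  refl = refl

port₃-vert : ∀ v l r → one (v ∷ l ∷ r ∷ []) ≡ true → v ≡ not (r ∨ l)
port₃-vert true  false false refl = refl
port₃-vert false true  false refl = refl
port₃-vert false false true  refl = refl

port₃-exclusive : ∀ v l r → one (v ∷ l ∷ r ∷ []) ≡ true → r ≡ true → l ≡ true → ⊥
port₃-exclusive false true true () refl refl

module Decode (n : ℕ) (φ : EName → Bool)
  (φ-valid : ∀ e → φ e ≡ true → ValidE n e) (φ-covers : ∀ v → ValidV n v → Covered φ v) where

  states : ∀ i s → i < n → ∃ (Agrees φ i s)
  states i s i<n = sideState φ i s λ k → φ-covers (node i s k) i<n

  ρ-agree : ∀ i → i < n → φ (edge i top ρ) ≡ φ (edge i bot ρ)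
  -- Both ports of a column are matched to the same side: this holds at the
  -- left end and propagates through the fragments.
  ℓ-agree : ∀ i → i < n → φ (edge i top ℓ) ≡ φ (edge i bot ℓ)

  ℓ-agree zero    h = port₂-agree (φ (vert 0)) _ _ (φ-covers (port 0 top) h) (φ-covers (port 0 bot) h)
  ℓ-agree (suc i) h = port₃-agree (φ (vert (suc i))) _ _ _ _
    (φ-covers (port (suc i) top) (<⇒≤ h)) (φ-covers (port (suc i) bot) (<⇒≤ h)) (ρ-agree i (<⇒≤ h))

  ρ-agree i h with t , eqᵗ , midᵗ ← states i top h | u , eqᵘ , midᵘ ← states i bot h =
    trans (eqᵗ ρ) (trans (ℓ-mid⇒ρ t u (trans (sym (eqᵗ ℓ)) (trans (ℓ-agree i h) (eqᵘ ℓ)))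
                                      (trans (sym midᵗ) midᵘ)) (sym (eqᵘ ρ)))

  word-agrees : ∀ i s → i < n → Agrees φ i s (state (word φ i) s)
  word-agrees i s h with t , eqᵗ , midᵗ ← states i top h | u , eqᵘ , midᵘ ← states i bot h =
    subst (Agrees φ i s) (sym eq) (onState-agrees s)
    where
    onState-agrees : ∀ s → Agrees φ i s (onState s t u)
    onState-agrees top = eqᵗ , midᵗ
    onState-agrees bot = eqᵘ , midᵘ

    word≡ : word φ i ≡ decode (usesMid t) (uses t ℓ) (uses t v₁) (uses u v₁)
    word≡ rewrite sym midᵗ | eqᵗ ℓ | eqᵗ v₁ | eqᵘ v₁ = refl

    eq : state (word φ i) s ≡ onState s t u
    eq = trans (cong (λ t → state t s) word≡)
      (state-decode t u s (trans (sym (eqᵗ ℓ)) (trans (ℓ-agree i h) (eqᵘ ℓ))) (trans (sym midᵗ) midᵘ))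

  word-ends : EndsAt n (word φ)
  word-ends i n≤i
    rewrite ¬-not {φ (mid i)} (λ h → <⇒≱ (φ-valid (mid i) h) n≤i)
          | ¬-not {φ (edge i top v₁)} (λ h → <⇒≱ (φ-valid (edge i top v₁) h) n≤i)
          | ¬-not {φ (edge i bot v₁)} (λ h → <⇒≱ (φ-valid (edge i bot v₁) h) n≤i) = refl

  φ-ℓ : ∀ i s → φ (edge i s ℓ) ≡ isˡ (word φ i)
  φ-ℓ i s with i <? n
  ... | yes i<n = trans (proj₁ (word-agrees i s i<n) ℓ) (uses-ℓ (word φ i) s)
  ... | no  i≮n rewrite word-ends i (≮⇒≥ i≮n) = ¬-not (i≮n ∘ φ-valid (edge i s ℓ))

  φ-ρ : ∀ i s → i < n → φ (edge i s ρ) ≡ isʳ (word φ i)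
  φ-ρ i s i<n = trans (proj₁ (word-agrees i s i<n) ρ) (uses-ρ (word φ i) s)

  φ-matching : ∀ e → ValidE n e → φ e ≡ matching (word φ) e
  φ-matching (vert zero)    h = trans (port₂-vert _ _ (φ-covers (port 0 top) h)) (cong not (φ-ℓ 0 top))
  φ-matching (vert (suc i)) h = trans (port₃-vert _ _ _ (φ-covers (port (suc i) top) h))
    (cong₂ (λ r l → not (r ∨ l)) (φ-ρ i top h) (φ-ℓ (suc i) top))
  φ-matching (mid i)        h = trans (proj₂ (word-agrees i top h)) (usesMid-state (word φ i) top)
  φ-matching (edge i s k)   h = proj₁ (word-agrees i s h) k

  word-admissible : Admissible (word φ)
  word-admissible i r l with i <? n
  ... | yes i<n = port₃-exclusive (φ (vert (suc i))) _ _ (φ-covers (port (suc i) top) i<n)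
                    (trans (φ-ρ i top i<n) r) (trans (φ-ℓ (suc i) top) l)
  ... | no  i≮n rewrite word-ends i (≮⇒≥ i≮n) with () ← r

-- The lower bound: disjoint alternating cycles

-- Every slot of a fragment stands for one of the chosen alternating cycles:
-- side s for the hexagon s₁ or s₂, hub for the cycle along the row, which
-- may extend into an adjacent fragment.
data Slot : Set where
  hub  : Slot
  side : Side → Slot

slots : Fragment → List Slot
slots (both L L) = hub ∷ side top ∷ side bot ∷ []
slots (both L R) = side top ∷ side bot ∷ []
slots (both R L) = side top ∷ side bot ∷ []
slots (both R R) = hub ∷ side top ∷ side bot ∷ []
slots inˡ        = hub ∷ []
slots inʳ        = hub ∷ []

-- The alternating cycle on which an edge outside the matching lies; junk if the
-- edge is on none of the chosen cycles.
ownerIn : ℕ → Fragment → Side → EKind → ℕ × Slot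
ownerIn i (both _ _) s ℓ  = i , hub
ownerIn i (both _ _) s ρ  = i , hub
ownerIn i (both _ _) s _  = i , side s
ownerIn i inʳ        s i₂ = suc i , hub
ownerIn i inʳ        s _  = i , hub
ownerIn i inˡ        s i₁ = pred i , hub
ownerIn i inˡ        s _  = i , hub

owner : Word → EName → ℕ × Slot
owner g (vert i)     = if afterʳ g i then (pred i , hub) else (i , hub)
owner g (mid i)      = i , hub
owner g (edge i s k) = ownerIn i (g i) s k

record Gain (i : ℕ) (t u : Fragment) (o : ℕ × Slot) : Set where
  constructor gain
  field
    gain-edge : ∀ s k → uses (state u s) k ≡ true → uses (state t s) k ≡ false → ownerIn i t s k ≡ o
    gain-mid  : isMid u ≡ true → isMid t ≡ false → (i , hub) ≡ o

open Gain

opposite : Dir → Dir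
opposite L = R
opposite R = L

gain-refl : ∀ {i t o} → Gain i t t o
gain-refl = gain (λ s k p q → contradiction (trans (sym p) q) λ ()) (λ p q → contradiction (trans (sym p) q) λ ())

gain-top : ∀ {i} x y → Gain i (both x y) (both (opposite x) y) (i , side top)
gain-top L y = gain (λ where
  top i₂ refl refl → refl
  top v₁ refl refl → refl
  top o₂ refl refl → refl
  bot k p q → contradiction (trans (sym p) q) λ ()) λ ()
gain-top R y = gain (λ where
  top i₁ refl refl → refl
  top v₂ refl refl → refl
  top o₁ refl refl → refl
  bot k p q → contradiction (trans (sym p) q) λ ()) λ ()

gain-bot : ∀ {i} x y → Gain i (both x y) (both x (opposite y)) (i , side bot)
gain-bot x L = gain (λ where
  bot i₂ refl refl → refl
  bot v₁ refl refl → refl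
  bot o₂ refl refl → refl
  top k p q → contradiction (trans (sym p) q) λ ()) λ ()
gain-bot x R = gain (λ where
  bot i₁ refl refl → refl
  bot v₂ refl refl → refl
  bot o₁ refl refl → refl
  top k p q → contradiction (trans (sym p) q) λ ()) λ ()

gain-LL-inˡ : ∀ {i} → Gain i (both L L) inˡ (i , hub)
gain-LL-inˡ = gain (λ { top ℓ refl refl → refl ; bot ℓ refl refl → refl }) (λ _ _ → refl)

gain-RR-inʳ : ∀ {i} → Gain i (both R R) inʳ (i , hub)
gain-RR-inʳ = gain (λ { top ρ refl refl → refl ; bot ρ refl refl → refl }) (λ _ _ → refl)

gain-inʳ-LL : ∀ {i} → Gain i inʳ (both L L) (i , hub)
gain-inʳ-LL = gain (λ where
  top i₁ refl refl → refl
  top v₂ refl refl → refl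
  top o₁ refl refl → refl
  bot i₁ refl refl → refl
  bot v₂ refl refl → refl
  bot o₁ refl refl → refl) λ ()

gain-inˡ-RR : ∀ {i} → Gain i inˡ (both R R) (i , hub)
gain-inˡ-RR = gain (λ where
  top i₂ refl refl → refl
  top v₁ refl refl → refl
  top o₂ refl refl → refl
  bot i₂ refl refl → refl
  bot v₁ refl refl → refl
  bot o₂ refl refl → refl) λ ()

gain-inʳ-RR : ∀ {i} → Gain i inʳ (both R R) (suc i , hub)
gain-inʳ-RR = gain (λ { top i₂ refl refl → refl ; bot i₂ refl refl → refl }) λ ()

gain-inˡ-LL : ∀ {i} → Gain (suc i) inˡ (both L L) (i , hub)
gain-inˡ-LL = gain (λ { top i₁ refl refl → refl ; bot i₁ refl refl → refl }) λ ()

gain-inʳ-inˡ : ∀ {i} → Gain i inʳ inˡ (i , hub)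
gain-inʳ-inˡ = gain (λ where
  s ℓ  refl refl → refl
  s v₂ refl refl → refl
  s o₁ refl refl → refl) λ _ _ → refl

gain-inˡ-inʳ : ∀ {i} → Gain i inˡ inʳ (i , hub)
gain-inˡ-inʳ = gain (λ where
  s ρ  refl refl → refl
  s v₁ refl refl → refl
  s o₂ refl refl → refl) λ _ _ → refl

record Move (n : ℕ) (g : Word) (o : ℕ × Slot) : Set where
  field
    g′         : Word
    admissible : Admissible g′
    endsAt     : EndsAt n g′
    changed    : ∃ λ i → i < n × g′ i ≢ g i
    owned      : ∀ e → matching g′ e ≡ true → matching g e ≡ false → owner g e ≡ o

not-∨-true : ∀ {a b} → not (a ∨ b) ≡ true → a ≡ false × b ≡ false
not-∨-true {false} {false} _ = refl , refl

not-∨-false : ∀ {a b} → not (a ∨ b) ≡ false → a ≡ false → b ≡ true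
not-∨-false {false} {true} _ _ = refl

owned-by : ∀ {g g′ o} → (∀ i → Gain i (g i) (g′ i) o) →
  (∀ i → isʳ (g i) ≡ true → isʳ (g′ i) ≡ false → isˡ (g′ (suc i)) ≡ false → (i , hub) ≡ o) →
  (∀ i → isˡ (g i) ≡ true → isˡ (g′ i) ≡ false → afterʳ g′ i ≡ false → (i , hub) ≡ o) →
  ∀ e → matching g′ e ≡ true → matching g e ≡ false → owner g e ≡ o
owned-by {g} {g′} gains r l (vert zero) p q =
  let a , b = not-∨-true {false} p in l 0 (not-∨-false {false} q refl) b a
owned-by {g} {g′} gains r l (vert (suc i)) p q with isʳ (g i) in eq
... | true  = let a , b = not-∨-true {isʳ (g′ i)} p in r i eq a b
... | false = let a , b = not-∨-true {isʳ (g′ i)} p in l (suc i) (not-∨-false {false} q refl) b a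
owned-by gains r l (mid i)      p q = gain-mid (gains i) p q
owned-by gains r l (edge i s k) p q = gain-edge (gains i) s k p q

_[_↦_] : Word → ℕ → Fragment → Word
(g [ i ↦ t ]) j with i ≟ⁿ j
... | yes _ = t
... | no  _ = g j

updated : ∀ g i t → (g [ i ↦ t ]) i ≡ t
updated g i t with i ≟ⁿ i
... | yes _ = refl
... | no  h = contradiction refl h

minimal : ∀ {g i t j} → i ≢ j → (g [ i ↦ t ]) j ≡ g j
minimal {i = i} {j = j} i≢j with i ≟ⁿ j
... | yes eq = contradiction eq i≢j
... | no  _  = refl

true≢false : ∀ {b : Bool} → b ≡ true → b ≢ false
true≢false refl ()

move₁ : ∀ {n g i t o} → Admissible g → EndsAt n g → i < n → t ≢ g i → Gain i (g i) t o →
  (isMid (g i) ≡ true → (i , hub) ≡ o) →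
  (isʳ t ≡ true → isˡ (g (suc i)) ≡ true → ⊥) → (isˡ t ≡ true → afterʳ g i ≡ true → ⊥) → Move n g o
move₁ {n} {g} {i} {t} {o} adm end i<n t≢ gn own noʳ noˡ = record
  { g′ = g′
  ; admissible = adm′
  ; endsAt = λ j n≤j → trans (minimal {g} {i} {t} λ { refl → <⇒≱ i<n n≤j }) (end j n≤j)
  ; changed = i , i<n , t≢ ∘ trans (sym (updated g i t))
  ; owned = owned-by gains ownʳ ownˡ
  }
  where
  g′ : Word
  g′ = g [ i ↦ t ]

  gains : ∀ j → Gain j (g j) (g′ j) o
  gains j with i ≟ⁿ j
  ... | yes refl = gn
  ... | no  _    = gain-refl

  ownʳ : ∀ j → isʳ (g j) ≡ true → isʳ (g′ j) ≡ false → isˡ (g′ (suc j)) ≡ false → (j , hub) ≡ o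
  ownʳ j p q _ with i ≟ⁿ j
  ... | yes refl = own (subst (λ t → isMid t ≡ true) (sym (isʳ⇒≡ p)) refl)
  ... | no  _    = contradiction q (true≢false p)

  ownˡ : ∀ j → isˡ (g j) ≡ true → isˡ (g′ j) ≡ false → afterʳ g′ j ≡ false → (j , hub) ≡ o
  ownˡ j p q _ with i ≟ⁿ j
  ... | yes refl = own (subst (λ t → isMid t ≡ true) (sym (isˡ⇒≡ p)) refl)
  ... | no  _    = contradiction q (true≢false p)

  adm′ : Admissible g′
  adm′ j p q with i ≟ⁿ j | i ≟ⁿ suc j
  ... | yes refl | yes eq   = 1+n≢n (sym eq)
  ... | yes refl | no _     = noʳ p q
  ... | no _     | yes refl = noˡ q p
  ... | no _     | no _     = adm j p q

-- The two changes are made in adjacent fragments; the cycle runs through the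
-- ports between them.
move₂ : ∀ {n g i t u o} → Admissible g → EndsAt n g → suc i < n → t ≢ g i →
  Gain i (g i) t o → Gain (suc i) (g (suc i)) u o →
  (isʳ (g i) ≡ true → isˡ u ≡ false → (i , hub) ≡ o) → (isˡ (g i) ≡ true → (i , hub) ≡ o) →
  (isʳ (g (suc i)) ≡ true → (suc i , hub) ≡ o) →
  (isˡ (g (suc i)) ≡ true → isʳ t ≡ false → (suc i , hub) ≡ o) →
  (isʳ t ≡ true → isˡ u ≡ true → ⊥) → isˡ t ≡ false → isʳ u ≡ false → Move n g o
move₂ {n} {g} {i} {t} {u} {o} adm end i<n t≢ gnᵗ gnᵘ ownᵗʳ ownᵗˡ ownᵘʳ ownᵘˡ apart t≢ˡ u≢ʳ = record
  { g′ = g′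
  ; admissible = adm′
  ; endsAt = λ j n≤j → trans (other (λ { refl → <⇒≱ (<⇒≤ i<n) n≤j }) λ { refl → <⇒≱ i<n n≤j }) (end j n≤j)
  ; changed = i , <⇒≤ i<n , t≢ ∘ trans (sym atᵗ)
  ; owned = owned-by gains ownʳ ownˡ
  }
  where
  g′ : Word
  g′ = (g [ i ↦ t ]) [ suc i ↦ u ]

  atᵗ : g′ i ≡ t
  atᵗ = trans (minimal {g [ i ↦ t ]} 1+n≢n) (updated g i t)

  atᵘ : g′ (suc i) ≡ u
  atᵘ = updated (g [ i ↦ t ]) (suc i) u

  other : ∀ {j} → i ≢ j → suc i ≢ j → g′ j ≡ g j
  other i≢ si≢ = trans (minimal {g [ i ↦ t ]} si≢) (minimal {g} i≢)

  data Place (j : ℕ) : Set where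
    first  : i ≡ j → Place j
    second : suc i ≡ j → Place j
    apart′ : i ≢ j → suc i ≢ j → Place j

  place : ∀ j → Place j
  place j with i ≟ⁿ j | suc i ≟ⁿ j
  ... | yes p | _     = first p
  ... | no _  | yes q = second q
  ... | no p  | no q  = apart′ p q

  gains : ∀ j → Gain j (g j) (g′ j) o
  gains j with place j
  ... | first refl  = subst (λ x → Gain i (g i) x o) (sym atᵗ) gnᵗ
  ... | second refl = subst (λ x → Gain (suc i) (g (suc i)) x o) (sym atᵘ) gnᵘ
  ... | apart′ p q  = subst (λ x → Gain j (g j) x o) (sym (other p q)) gain-refl

  ownʳ : ∀ j → isʳ (g j) ≡ true → isʳ (g′ j) ≡ false → isˡ (g′ (suc j)) ≡ false → (j , hub) ≡ o
  ownʳ j p q r with place j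
  ... | first refl  = ownᵗʳ p (subst (λ x → isˡ x ≡ false) atᵘ r)
  ... | second refl = ownᵘʳ p
  ... | apart′ a b  = contradiction (subst (λ x → isʳ x ≡ false) (other a b) q) (true≢false p)

  ownˡ : ∀ j → isˡ (g j) ≡ true → isˡ (g′ j) ≡ false → afterʳ g′ j ≡ false → (j , hub) ≡ o
  ownˡ j p q r with place j
  ... | first refl  = ownᵗˡ p
  ... | second refl = ownᵘˡ p (subst (λ x → isʳ x ≡ false) atᵗ r)
  ... | apart′ a b  = contradiction (subst (λ x → isˡ x ≡ false) (other a b) q) (true≢false p)

  adm′ : Admissible g′
  adm′ j p q with place j | place (suc j)
  ... | first refl  | _           = apart (subst (λ x → isʳ x ≡ true) atᵗ p) (subst (λ x → isˡ x ≡ true) atᵘ q)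
  ... | second refl | _           = true≢false (subst (λ x → isʳ x ≡ true) atᵘ p) u≢ʳ
  ... | apart′ _ _  | first refl  = true≢false (subst (λ x → isˡ x ≡ true) atᵗ q) t≢ˡ
  ... | apart′ a _  | second eq   = a (suc-injective eq)
  ... | apart′ a b  | apart′ c d  =
    adm j (subst (λ x → isʳ x ≡ true) (other a b) p) (subst (λ x → isˡ x ≡ true) (other c d) q)

move-hub-afterʳ : ∀ {n g i} → Admissible g → EndsAt n g → suc i < n → isʳ (g i) ≡ true →
  Gain (suc i) (g (suc i)) inˡ (suc i , hub) → Move n g (suc i , hub)
move-hub-afterʳ {g = g} {i} adm end h r gn with g i in eq
... | inʳ = move₂ {t = both R R} {u = inˡ} adm end h (λ eq′ → contradiction (trans eq′ eq) λ ())
  (subst (λ x → Gain i x (both R R) (suc i , hub)) (sym eq) gain-inʳ-RR) gn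
  (λ _ ()) (λ l → contradiction (trans (sym l) (cong isˡ eq)) λ ()) (λ _ → refl) (λ _ _ → refl) (λ ()) refl refl

move-hub-beforeˡ : ∀ {n g i} → Admissible g → EndsAt n g → isˡ (g (suc i)) ≡ true → isʳ (g i) ≡ false →
  Gain i (g i) inʳ (i , hub) → Move n g (i , hub)
move-hub-beforeˡ {n} {g} {i} adm end l r gn with g (suc i) in eq
... | inˡ = move₂ {t = inʳ} {u = both L L} adm end suc-i<n (λ p → true≢false (cong isʳ (sym p)) r) gn
  (subst (λ x → Gain (suc i) x (both L L) (i , hub)) (sym eq) gain-inˡ-LL)
  (λ _ _ → refl) (λ _ → refl) (λ q → contradiction (trans (sym q) (cong isʳ eq)) λ ()) (λ _ ()) (λ _ ()) refl refl
  where
  suc-i<n : suc i < n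
  suc-i<n with suc i <? n
  ... | yes h = h
  ... | no  h = contradiction (trans (sym eq) (end (suc i) (≮⇒≥ h))) λ ()

afterʳ⇒suc : ∀ {g} i → afterʳ g i ≡ true → ∃ λ j → i ≡ suc j × isʳ (g j) ≡ true
afterʳ⇒suc (suc j) h = j , refl , h

move : ∀ {n g} → Admissible g → EndsAt n g → ∀ {i σ} → i < n → σ ∈ˡ slots (g i) → Move n g (i , σ)
move {n} {g} adm end {i} {σ} i<n σ∈ = go (g i) refl σ∈
  where
  Gain-at : ∀ {t} u o → g i ≡ t → Gain i t u o → Gain i (g i) u o
  Gain-at u o eq = subst (λ t → Gain i t u o) (sym eq)

  flip-top : ∀ x y → g i ≡ both x y → Move n g (i , side top)
  flip-top x y eq = move₁ {t = both (opposite x) y} adm end i<n (≢ x ∘ λ p → trans p eq)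
    (Gain-at _ _ eq (gain-top x y)) (λ m → contradiction (trans (sym m) (cong isMid eq)) λ ()) (λ ()) (λ ())
    where
    ≢ : ∀ x → both (opposite x) y ≢ both x y
    ≢ L ()
    ≢ R ()

  flip-bot : ∀ x y → g i ≡ both x y → Move n g (i , side bot)
  flip-bot x y eq = move₁ {t = both x (opposite y)} adm end i<n (≢ y ∘ λ p → trans p eq)
    (Gain-at _ _ eq (gain-bot x y)) (λ m → contradiction (trans (sym m) (cong isMid eq)) λ ()) (λ ()) (λ ())
    where
    ≢ : ∀ y → both x (opposite y) ≢ both x y
    ≢ L ()
    ≢ R ()

  hubˡ : ∀ u → Gain i (g i) inˡ (i , hub) → u ≢ g i → Gain i (g i) u (i , hub) → isʳ u ≡ false →
         Move n g (i , hub)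
  hubˡ u gn u≢ gn′ u≢ʳ with afterʳ g i in eq
  ... | true with j , refl , r ← afterʳ⇒suc i eq = move-hub-afterʳ adm end i<n r gn
  ... | false = move₁ {t = u} adm end i<n u≢ gn′ (λ _ → refl) (λ r → contradiction u≢ʳ (true≢false r))
      (λ _ q → contradiction eq (true≢false q))

  hubʳ : ∀ u → isʳ (g i) ≡ false → Gain i (g i) inʳ (i , hub) → u ≢ g i → Gain i (g i) u (i , hub) → isˡ u ≡ false →
         Move n g (i , hub)
  hubʳ u g≢ʳ gn u≢ gn′ u≢ˡ with isˡ (g (suc i)) in eq
  ... | true  = move-hub-beforeˡ adm end eq g≢ʳ gn
  ... | false = move₁ {t = u} adm end i<n u≢ gn′ (λ _ → refl) (λ _ q → contradiction eq (true≢false q))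
      (λ l → contradiction u≢ˡ (true≢false l))

  go : ∀ t → g i ≡ t → σ ∈ˡ slots t → Move n g (i , σ)
  go (both L L) eq (here refl) = hubˡ inˡ (Gain-at _ _ eq gain-LL-inˡ)
    (λ p → contradiction (trans p eq) λ ()) (Gain-at _ _ eq gain-LL-inˡ) refl
  go (both L L) eq (there (here refl)) = flip-top L L eq
  go (both L L) eq (there (there (here refl))) = flip-bot L L eq
  go (both L R) eq (here refl) = flip-top L R eq
  go (both L R) eq (there (here refl)) = flip-bot L R eq
  go (both R L) eq (here refl) = flip-top R L eq
  go (both R L) eq (there (here refl)) = flip-bot R L eq
  go (both R R) eq (here refl) = hubʳ inʳ (cong isʳ eq) (Gain-at _ _ eq gain-RR-inʳ)
    (λ p → contradiction (trans p eq) λ ()) (Gain-at _ _ eq gain-RR-inʳ) refl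
  go (both R R) eq (there (here refl)) = flip-top R R eq
  go (both R R) eq (there (there (here refl))) = flip-bot R R eq
  go inˡ eq (here refl) = hubʳ (both R R) (cong isʳ eq) (Gain-at _ _ eq gain-inˡ-inʳ)
    (λ p → contradiction (trans p eq) λ ()) (Gain-at _ _ eq gain-inˡ-RR) refl
  go inʳ eq (here refl) = hubˡ (both L L) (Gain-at _ _ eq gain-inʳ-inˡ)
    (λ p → contradiction (trans p eq) λ ()) (Gain-at _ _ eq gain-inʳ-LL) refl

-- The upper bound: an explicit anti-forcing set

far : Dir → EKind
far L = o₂
far R = o₁

-- In both L L and both R R, mid excludes inˡ and inʳ; in both L R and both R L
-- the edges o₁, o₂ of opposite sides already do.
blockers : Fragment → ℕ → List EName
blockers (both L L) i = mid i ∷ edge i top (far L) ∷ edge i bot (far L) ∷ []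
blockers (both L R) i = edge i top (far L) ∷ edge i bot (far R) ∷ []
blockers (both R L) i = edge i top (far R) ∷ edge i bot (far L) ∷ []
blockers (both R R) i = mid i ∷ edge i top (far R) ∷ edge i bot (far R) ∷ []
blockers inˡ        i = vert i ∷ []
blockers inʳ        i = vert (suc i) ∷ []

length-blockers : ∀ t i → length (blockers t i) ≡ length (slots t)
length-blockers (both L L) i = refl
length-blockers (both L R) i = refl
length-blockers (both R L) i = refl
length-blockers (both R R) i = refl
length-blockers inˡ        i = refl
length-blockers inʳ        i = refl

Avoids : Word → List EName → Set
Avoids g = All (λ e → matching g e ≡ false)

avoids-blockers : ∀ g i → Avoids g (blockers (g i) i)
avoids-blockers g i = go (g i) refl
  where
  on : ∀ s {k t} → g i ≡ t → matching g (edge i s k) ≡ uses (state t s) k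
  on s {k} = cong (λ t → uses (state t s) k)

  go : ∀ t → g i ≡ t → Avoids g (blockers t i)
  go (both L L) eq = cong isMid eq ∷ on top eq ∷ on bot eq ∷ []
  go (both L R) eq = on top eq ∷ on bot eq ∷ []
  go (both R L) eq = on top eq ∷ on bot eq ∷ []
  go (both R R) eq = cong isMid eq ∷ on top eq ∷ on bot eq ∷ []
  go inˡ        eq = cong not (trans (cong (afterʳ g i ∨_) (cong isˡ eq)) (∨-zeroʳ (afterʳ g i))) ∷ []
  go inʳ        eq = cong (λ t → not (isʳ t ∨ isˡ (g (suc i)))) eq ∷ []

blocked : ∀ {g} i x y → Avoids g (blockers (both x y) i) → g i ≡ both x y
blocked {g} i L L (m ∷ a ∷ b ∷ []) with both L L ← g i = refl
blocked {g} i L R (a ∷ b ∷ []) with both L R ← g i = refl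
blocked {g} i R L (a ∷ b ∷ []) with both R L ← g i = refl
blocked {g} i R R (m ∷ a ∷ b ∷ []) with both R R ← g i = refl

module Blocked {n g g′} (adm : Admissible g) (end′ : EndsAt n g′)
  (avoids : ∀ i → i < n → Avoids g′ (blockers (g i) i)) where

  blocked-both : ∀ i x y → i < n → g i ≡ both x y → g′ i ≡ both x y
  blocked-both i x y i<n eq = blocked i x y (subst (λ t → Avoids g′ (blockers t i)) eq (avoids i i<n))

  blocked-inˡ : ∀ i → i < n → g i ≡ inˡ → afterʳ g′ i ≡ false → isˡ (g′ i) ≡ true
  blocked-inˡ i i<n eq r with h ∷ [] ← subst (λ t → Avoids g′ (blockers t i)) eq (avoids i i<n) =
    not-∨-false {afterʳ g′ i} h r

  blocked-inʳ : ∀ i → i < n → g i ≡ inʳ → isʳ (g′ i) ≡ false → isˡ (g′ (suc i)) ≡ true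
  blocked-inʳ i i<n eq r with h ∷ [] ← subst (λ t → Avoids g′ (blockers t i)) eq (avoids i i<n) =
    not-∨-false {isʳ (g′ i)} h r

  -- A fragment inˡ of g′ to the right of an inʳ of g would propagate to the
  -- right end.
  no-inˡ : ∀ d i → n ≤ d +ⁿ i → g i ≡ inʳ → isˡ (g′ (suc i)) ≡ true → ⊥
  no-inˡ d i n≤ eq l with suc i <? n
  ... | no h = true≢false l (cong isˡ (end′ (suc i) (≮⇒≥ h)))
  no-inˡ zero    i n≤ eq l | yes h = <⇒≱ (<⇒≤ h) n≤
  no-inˡ (suc d) i n≤ eq l | yes h with g (suc i) in eq′
  ... | both x y = true≢false l (cong isˡ (blocked-both (suc i) x y h eq′))
  ... | inˡ      = adm i (cong isʳ eq) (cong isˡ eq′)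
  ... | inʳ      = no-inˡ d (suc i) (subst (n ≤_) (sym (+-suc d i)) n≤) eq′
                     (blocked-inʳ (suc i) h eq′ (cong isʳ (isˡ⇒≡ l)))

  agree : ∀ i → i < n → g′ i ≡ g i
  agree-afterʳ : ∀ i → i < n → afterʳ g′ i ≡ afterʳ g i

  agree i i<n with g i in eq
  ... | both x y = blocked-both i x y i<n eq
  ... | inˡ      = isˡ⇒≡ (blocked-inˡ i i<n eq
                     (trans (agree-afterʳ i i<n) (adm-afterʳ {g} adm i (cong isˡ eq))))
  ... | inʳ with isʳ (g′ i) in r
  ...   | true  = isʳ⇒≡ r
  ...   | false = ⊥-elim (no-inˡ n i (m≤m+n n i) eq (blocked-inʳ i i<n eq r))

  agree-afterʳ zero    _   = refl
  agree-afterʳ (suc i) i<n = cong isʳ (agree i (<⇒≤ i<n))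

-- Admissible words of length n

get : ∀ {n} → Vec Fragment n → Word
get []      _       = both L L
get (t ∷ w) zero    = t
get (t ∷ w) (suc i) = get w i

get-ends : ∀ {n} (w : Vec Fragment n) → EndsAt n (get w)
get-ends []      i       _         = refl
get-ends (t ∷ w) (suc i) (s≤s n≤i) = get-ends w i n≤i

get-injective : ∀ {n} (w w′ : Vec Fragment n) → (∀ i → i < n → get w i ≡ get w′ i) → w ≡ w′
get-injective []      []        eq = refl
get-injective (t ∷ w) (t′ ∷ w′) eq =
  cong₂ _∷_ (eq 0 (s≤s z≤n)) (get-injective w w′ λ i i<n → eq (suc i) (s≤s i<n))

prefix : ∀ n → Word → Vec Fragment n
prefix zero    g = []
prefix (suc n) g = g 0 ∷ prefix n (g ∘ suc)

get-prefix : ∀ n {g} → EndsAt n g → ∀ i → get (prefix n g) i ≡ g i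
get-prefix zero    end i       = sym (end i z≤n)
get-prefix (suc n) end zero    = refl
get-prefix (suc n) end (suc i) = get-prefix n (λ j n≤j → end (suc j) (s≤s n≤j)) i

branch : ∀ {n} (ws vs : List (Vec Fragment n)) → Fragment → List (Vec Fragment (suc n))
branch ws vs t = map (t ∷_) (if isʳ t then vs else ws)

extend : ∀ {n} → List Fragment → (ws vs : List (Vec Fragment n)) → List (Vec Fragment (suc n))
extend ts ws vs = concatMap (branch ws vs) ts

tameFragments : List Fragment
tameFragments = both L L ∷ both L R ∷ both R L ∷ both R R ∷ inʳ ∷ []

-- tameWords n lists the words that may follow inʳ.
words tameWords : ∀ n → List (Vec Fragment n)
words zero        = [] ∷ []
words (suc n)     = extend (inˡ ∷ tameFragments) (words n) (tameWords n)
tameWords zero    = [] ∷ []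
tameWords (suc n) = extend tameFragments (words n) (tameWords n)

∈-tameFragments : ∀ t → isˡ t ≡ false → t ∈ˡ tameFragments
∈-tameFragments (both L L) _ = here refl
∈-tameFragments (both L R) _ = there (here refl)
∈-tameFragments (both R L) _ = there (there (here refl))
∈-tameFragments (both R R) _ = there (there (there (here refl)))
∈-tameFragments inʳ        _ = there (there (there (there (here refl))))

fragments-unique : Unique (inˡ ∷ tameFragments)
fragments-unique =
  ((λ ()) ∷ (λ ()) ∷ (λ ()) ∷ (λ ()) ∷ (λ ()) ∷ []) ∷ ((λ ()) ∷ (λ ()) ∷ (λ ()) ∷ (λ ()) ∷ []) ∷
  ((λ ()) ∷ (λ ()) ∷ (λ ()) ∷ []) ∷ ((λ ()) ∷ (λ ()) ∷ []) ∷ ((λ ()) ∷ []) ∷ [] ∷ []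

extend-unique : ∀ {n ts} {ws vs : List (Vec Fragment n)} → Unique ts → Unique ws → Unique vs →
                Unique (extend ts ws vs)
extend-unique {ws = ws} {vs} ts! ws! vs! = Unique.concat⁺
  (All.map⁺ (tabulateᴬ λ {t} _ → Unique.map⁺ ∷-injectiveʳ (rest! t)))
  (AllPairs.map⁺ {f = branch ws vs} (mapᴾ disjoint ts!))
  where
  rest! : ∀ t → Unique (if isʳ t then vs else ws)
  rest! (both _ _) = ws!
  rest! inˡ        = ws!
  rest! inʳ        = vs!

  disjoint : ∀ {t u} → t ≢ u → Disjoint (branch ws vs t) (branch ws vs u)
  disjoint t≢u (w∈t , w∈u) with _ , _ , refl ← ∈-map⁻ _ w∈t | _ , _ , eq ← ∈-map⁻ _ w∈u = t≢u (∷-injectiveˡ eq)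

words-unique : ∀ n → Unique (words n)
tameWords-unique : ∀ n → Unique (tameWords n)
words-unique zero        = [] ∷ []
words-unique (suc n)     = extend-unique fragments-unique (words-unique n) (tameWords-unique n)
tameWords-unique zero    = [] ∷ []
tameWords-unique (suc n) with _ ∷ ts! ← fragments-unique = extend-unique ts! (words-unique n) (tameWords-unique n)

Tame : ∀ {n} → Vec Fragment n → Set
Tame w = Admissible (get w) × isˡ (get w 0) ≡ false

admissible-∷ : ∀ {n t} {w : Vec Fragment n} → Admissible (get w) →
               (isʳ t ≡ true → isˡ (get w 0) ≡ true → ⊥) → Admissible (get (t ∷ w))
admissible-∷ adm h zero    = h
admissible-∷ adm h (suc i) = adm i

extend⁻ : ∀ {n ts} {ws vs : List (Vec Fragment n)} →
  (∀ {w} → w ∈ˡ ws → Admissible (get w)) → (∀ {w} → w ∈ˡ vs → Tame w) →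
  ∀ {w} → w ∈ˡ extend ts ws vs → Admissible (get w) × get w 0 ∈ˡ ts
extend⁻ {ts = ts} {ws} {vs} hw hv w∈
  with t , t∈ , w∈t ← find (∈-concatMap⁻ (branch ws vs) {xs = ts} w∈)
  with w , w∈ , refl ← ∈-map⁻ (t ∷_) w∈t = adm t w∈ , t∈
  where
  adm : ∀ t → w ∈ˡ (if isʳ t then vs else ws) → Admissible (get (t ∷ w))
  adm (both x y) h = admissible-∷ {t = both x y} {w} (hw h) λ ()
  adm inˡ        h = admissible-∷ {t = inˡ} {w} (hw h) λ ()
  adm inʳ        h = admissible-∷ {t = inʳ} {w} (proj₁ (hv h)) λ _ l → true≢false l (proj₂ (hv h))

extend⁺ : ∀ {n ts} {ws vs : List (Vec Fragment n)} →
  (∀ {w} → Admissible (get w) → w ∈ˡ ws) → (∀ {w} → Tame w → w ∈ˡ vs) →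
  ∀ {t w} → Admissible (get (t ∷ w)) → t ∈ˡ ts → (t ∷ w) ∈ˡ extend ts ws vs
extend⁺ {ws = ws} {vs} hw hv {t} {w} adm t∈ =
  ∈-concatMap⁺ (branch ws vs) (lose t∈ (∈-map⁺ (t ∷_) (rest t adm)))
  where
  rest : ∀ t → Admissible (get (t ∷ w)) → w ∈ˡ (if isʳ t then vs else ws)
  rest (both x y) adm = hw (adm ∘ suc)
  rest inˡ        adm = hw (adm ∘ suc)
  rest inʳ        adm = hv ((adm ∘ suc) , ¬-not (adm 0 refl))

∈-words⁻ : ∀ {n w} → w ∈ˡ words n → Admissible (get w)
∈-tameWords⁻ : ∀ {n w} → w ∈ˡ tameWords n → Tame w
∈-words⁻ {zero} (here refl) i ()
∈-words⁻ {suc n} w∈ = proj₁ (extend⁻ {ts = inˡ ∷ tameFragments} (∈-words⁻ {n}) (∈-tameWords⁻ {n}) w∈)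
∈-tameWords⁻ {zero} (here refl) = (λ _ ()) , refl
∈-tameWords⁻ {suc n} w∈ with adm , t∈ ← extend⁻ {ts = tameFragments} (∈-words⁻ {n}) (∈-tameWords⁻ {n}) w∈ =
  adm , lookupᴬ {P = λ t → isˡ t ≡ false} (refl ∷ refl ∷ refl ∷ refl ∷ refl ∷ []) t∈

∈-words⁺ : ∀ {n w} → Admissible (get w) → w ∈ˡ words n
∈-tameWords⁺ : ∀ {n w} → Tame w → w ∈ˡ tameWords n
∈-words⁺ {zero}  {[]}    _   = here refl
∈-words⁺ {suc n} {t ∷ w} adm = extend⁺ {ts = inˡ ∷ tameFragments} ∈-words⁺ ∈-tameWords⁺ adm (∈-fragments t)
  where
  ∈-fragments : ∀ t → t ∈ˡ inˡ ∷ tameFragments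
  ∈-fragments inˡ        = here refl
  ∈-fragments inʳ        = there (∈-tameFragments inʳ refl)
  ∈-fragments (both x y) = there (∈-tameFragments (both x y) refl)
∈-tameWords⁺ {zero}  {[]}    _         = here refl
∈-tameWords⁺ {suc n} {t ∷ w} (adm , l) =
  extend⁺ {ts = tameFragments} ∈-words⁺ ∈-tameWords⁺ adm (∈-tameFragments t l)

weight : ∀ {n} → Vec Fragment n → ℕ
weight []      = 0
weight (t ∷ w) = length (slots t) +ⁿ weight w

totalWeight : ∀ {n} → List (Vec Fragment n) → ℕ
totalWeight ws = sum (map weight ws)

totalWeight-∷ : ∀ {n} t (ws : List (Vec Fragment n)) →
                totalWeight (map (t ∷_) ws) ≡ length (slots t) *ⁿ length ws +ⁿ totalWeight ws
totalWeight-∷ t []       = sym (trans (+-comm _ 0) (*-zeroʳ (length (slots t))))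
totalWeight-∷ t (w ∷ ws) rewrite totalWeight-∷ t ws =
  rearrange (length (slots t)) (weight w) (length ws) (totalWeight ws)
  where
  rearrange : ∀ a b c d → a +ⁿ b +ⁿ (a *ⁿ c +ⁿ d) ≡ a *ⁿ suc c +ⁿ (b +ⁿ d)
  rearrange = solve-∀

length-extend : ∀ {n} ts (ws vs : List (Vec Fragment n)) →
  length (extend ts ws vs) ≡ sum (map (λ t → length (if isʳ t then vs else ws)) ts)
length-extend []       ws vs = refl
length-extend (t ∷ ts) ws vs = trans (length-++ (map (t ∷_) (if isʳ t then vs else ws)))
  (cong₂ _+ⁿ_ (length-map (t ∷_) (if isʳ t then vs else ws)) (length-extend ts ws vs))

totalWeight-extend : ∀ {n} ts (ws vs : List (Vec Fragment n)) →
  totalWeight (extend ts ws vs) ≡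
  sum (map (λ t → let us = if isʳ t then vs else ws in length (slots t) *ⁿ length us +ⁿ totalWeight us) ts)
totalWeight-extend []       ws vs = refl
totalWeight-extend (t ∷ ts) ws vs = begin
  sum (map weight (map (t ∷_) us ++ extend ts ws vs))            ≡⟨ cong sum (map-++ weight (map (t ∷_) us) _) ⟩
  sum (map weight (map (t ∷_) us) ++ map weight (extend ts ws vs)) ≡⟨ sum-++ (map weight (map (t ∷_) us)) _ ⟩
  totalWeight (map (t ∷_) us) +ⁿ totalWeight (extend ts ws vs)   ≡⟨ cong₂ _+ⁿ_ (totalWeight-∷ t us)
                                                                             (totalWeight-extend ts ws vs) ⟩
  _                                                              ∎
  where
  open ≡-Reasoning
  us = if isʳ t then vs else ws

wordWeight : ℕ → Word → ℕ
wordWeight n g = sum (applyUpTo (length ∘ slots ∘ g) n)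

wordWeight-get : ∀ {n} (w : Vec Fragment n) → wordWeight n (get w) ≡ weight w
wordWeight-get []      = refl
wordWeight-get (t ∷ w) = cong (length (slots t) +ⁿ_) (wordWeight-get w)

allSlots : ℕ → Word → List (ℕ × Slot)
allSlots n g = concat (applyUpTo (λ i → map (i ,_) (slots (g i))) n)

length-allSlots : ∀ n g → length (allSlots n g) ≡ wordWeight n g
length-allSlots n g = trans (length-concat-applyUpTo (λ i → map (i ,_) (slots (g i))) n)
  (cong sum (applyUpTo-cong (λ i → length-map (i ,_) (slots (g i))) n))

slots-unique : ∀ t → Unique (slots t)
slots-unique (both L L) = ((λ ()) ∷ (λ ()) ∷ []) ∷ ((λ ()) ∷ []) ∷ [] ∷ []
slots-unique (both L R) = ((λ ()) ∷ []) ∷ [] ∷ []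
slots-unique (both R L) = ((λ ()) ∷ []) ∷ [] ∷ []
slots-unique (both R R) = ((λ ()) ∷ (λ ()) ∷ []) ∷ ((λ ()) ∷ []) ∷ [] ∷ []
slots-unique inˡ        = [] ∷ []
slots-unique inʳ        = [] ∷ []

allSlots-unique : ∀ n g → Unique (allSlots n g)
allSlots-unique n g = Unique.concat⁺
  (All.applyUpTo⁺₂ _ n λ i → Unique.map⁺ ,-injectiveʳ (slots-unique (g i)))
  (AllPairs.applyUpTo⁺₁ _ n λ i<j _ → disjoint (<⇒≢ i<j))
  where
  disjoint : ∀ {i j} → i ≢ j → Disjoint (map (i ,_) (slots (g i))) (map (j ,_) (slots (g j)))
  disjoint i≢j (p , q) with _ , _ , refl ← ∈-map⁻ _ p | _ , _ , eq ← ∈-map⁻ _ q = i≢j (cong proj₁ eq)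

∈-allSlots⁻ : ∀ n g {i σ} → (i , σ) ∈ˡ allSlots n g → i < n × σ ∈ˡ slots (g i)
∈-allSlots⁻ n g h
  with _ , h , xs∈ ← ∈-concat⁻′ (applyUpTo (λ i → map (i ,_) (slots (g i))) n) h
  with j , j<n , refl ← ∈-applyUpTo⁻ _ xs∈
  with _ , σ∈ , refl ← ∈-map⁻ _ h = j<n , σ∈

blockers-valid : ∀ {n i} t → i < n → All (ValidE n) (blockers t i)
blockers-valid (both L L) h = h ∷ h ∷ h ∷ []
blockers-valid (both L R) h = h ∷ h ∷ []
blockers-valid (both R L) h = h ∷ h ∷ []
blockers-valid (both R R) h = h ∷ h ∷ h ∷ []
blockers-valid inˡ        h = vert-valid h ∷ []
blockers-valid inʳ        h = h ∷ []

allBlockers : ℕ → Word → List EName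
allBlockers n g = concat (applyUpTo (λ i → blockers (g i) i) n)

length-allBlockers : ∀ n g → length (allBlockers n g) ≡ wordWeight n g
length-allBlockers n g = trans (length-concat-applyUpTo (λ i → blockers (g i) i) n)
  (cong sum (applyUpTo-cong (λ i → length-blockers (g i) i) n))

admissible-cong : ∀ {g g′} → (∀ i → g i ≡ g′ i) → Admissible g → Admissible g′
admissible-cong eq adm i r l = adm i (trans (cong isʳ (eq i)) r) (trans (cong isˡ (eq (suc i))) l)

module PyreneSystem (n : ℕ) (vs : List Point) (es : List (Point × Point))
  (ep : All (λ (u , v) → u ∈ˡ vs × v ∈ˡ vs) es) (isPyreneSystem : IsPyreneSystem n vs es) where

  G : Graph
  G = record { V = Point ; _≟_ = _≟ᵖ_ ; vertices = vs ; edges = es ; endpoints = ep }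

  open Graph G hiding (_≟_)
  open IsPyreneSystem isPyreneSystem

  name : Edge → EName
  name f = proj₁ (edges⁻ (∈-lookup f))

  name-valid : ∀ f → ValidE n (name f)
  name-valid f = proj₁ (proj₂ (edges⁻ (∈-lookup f)))

  ends-name : ∀ f → lookup edges f ≡ ends (name f)
  ends-name f = proj₂ (proj₂ (edges⁻ (∈-lookup f)))

  name-injective : ∀ {f g} → name f ≡ name g → f ≡ g
  name-injective {f} {g} eq =
    lookup-injective edges-unique (trans (ends-name f) (trans (cong ends eq) (sym (ends-name g))))

  position : ∀ {e} → ValidE n e → ∃ λ f → name f ≡ e
  position v = index (edges⁺ v) ,
    ends-injective (trans (sym (ends-name _)) (sym (lookup-index (edges⁺ v))))

  incident⁺ : ∀ {v} f → IncidentTo v (name f) → Incident (point v) f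
  incident⁺ f (inj₁ refl) = inj₁ (sym (cong proj₁ (ends-name f)))
  incident⁺ f (inj₂ refl) = inj₂ (sym (cong proj₂ (ends-name f)))

  incident⁻ : ∀ {v} f → Incident (point v) f → IncidentTo v (name f)
  incident⁻ f (inj₁ eq) = inj₁ (point-injective (trans eq (cong proj₁ (ends-name f))))
  incident⁻ f (inj₂ eq) = inj₂ (point-injective (trans eq (cong proj₂ (ends-name f))))

  ⟦_⟧ : (EName → Bool) → EdgeSet
  ⟦ φ ⟧ = tabulate (φ ∘ name)

  ∈⟦⟧⁺ : ∀ φ {f} → φ (name f) ≡ true → f ∈ ⟦ φ ⟧
  ∈⟦⟧⁺ φ {f} h = lookup⇒[]= f ⟦ φ ⟧ (trans (lookup∘tabulate (φ ∘ name) f) h)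

  ∈⟦⟧⁻ : ∀ φ {f} → f ∈ ⟦ φ ⟧ → φ (name f) ≡ true
  ∈⟦⟧⁻ φ {f} h = trans (sym (lookup∘tabulate (φ ∘ name) f)) ([]=⇒lookup h)

  contains? : ∀ M e → Dec (∃ λ f → name f ≡ e × f ∈ M)
  contains? M e = any? λ f → (name f ≟ᵉ e) ×-dec (f ∈? M)

  χ : EdgeSet → EName → Bool
  χ M e = does (contains? M e)

  χ⁺ : ∀ {M f} → f ∈ M → χ M (name f) ≡ true
  χ⁺ f∈ = dec-true (contains? _ _) (_ , refl , f∈)

  χ⁻ : ∀ M {e} → χ M e ≡ true → ∃ λ f → name f ≡ e × f ∈ M
  χ⁻ M {e} h with yes p ← contains? M e = p

  χ-valid : ∀ M {e} → χ M e ≡ true → ValidE n e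
  χ-valid M h with f , refl , _ ← χ⁻ M h = name-valid f

  ⟦⟧-unique : ∀ {M φ} → (∀ e → ValidE n e → χ M e ≡ φ e) → M ≡ ⟦ φ ⟧
  ⟦⟧-unique {M} {φ} h = ⊆-antisym
    (λ {f} f∈ → ∈⟦⟧⁺ φ (trans (sym (h (name f) (name-valid f))) (χ⁺ f∈)))
    λ {f} f∈ → back f (χ⁻ M (trans (h (name f) (name-valid f)) (∈⟦⟧⁻ φ f∈)))
    where
    back : ∀ f → (∃ λ g → name g ≡ name f × g ∈ M) → f ∈ M
    back f (g , eq , g∈) = subst (_∈ M) (name-injective eq) g∈

  covered⇒coveredOnce : ∀ φ v → (∀ {e} → e ∈ˡ inc v → φ e ≡ true → ValidE n e) →
                        Covered φ v → CoveredOnce ⟦ φ ⟧ (point v)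
  covered⇒coveredOnce φ v valid h
    with e , e∈ , φe , only ← one⁻ φ (inc v) h
    with f , refl ← position (valid e∈ φe)
    = f , (∈⟦⟧⁺ φ φe , incident⁺ f (lookupᴬ (inc-sound v) e∈)) , λ {g} (g∈ , inc-g) →
      name-injective (only (inc-complete (name g) (incident⁻ g inc-g)) (∈⟦⟧⁻ φ g∈))

  coveredOnce⇒covered : ∀ M v → CoveredOnce M (point v) → Covered (χ M) v
  coveredOnce⇒covered M v (f , (f∈ , inc-f) , only) =
    one⁺ (χ M) (inc-unique v) (inc-complete (name f) (incident⁻ f inc-f)) (χ⁺ f∈) unique
    where
    unique : ∀ {e} → e ∈ˡ inc v → χ M e ≡ true → name f ≡ e
    unique e∈ h with g , refl , g∈ ← χ⁻ M h =
      cong name (only (g∈ , incident⁺ g (lookupᴬ (inc-sound v) e∈)))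

  ⟦⟧-cong : ∀ {φ ψ} → (∀ e → ValidE n e → φ e ≡ ψ e) → ⟦ φ ⟧ ≡ ⟦ ψ ⟧
  ⟦⟧-cong {φ} {ψ} eq = ⊆-antisym
    (λ {f} f∈ → ∈⟦⟧⁺ ψ (trans (sym (eq (name f) (name-valid f))) (∈⟦⟧⁻ φ f∈)))
    (λ {f} f∈ → ∈⟦⟧⁺ φ (trans (eq (name f) (name-valid f)) (∈⟦⟧⁻ ψ f∈)))

  ⟦⟧-injective : ∀ {φ ψ} → ⟦ φ ⟧ ≡ ⟦ ψ ⟧ → ∀ {e} → ValidE n e → φ e ≡ ψ e
  ⟦⟧-injective {φ} {ψ} eq v with f , refl ← position v =
    trans (sym (lookup∘tabulate (φ ∘ name) f)) (trans (cong (λ M → lookupᵛ M f) eq) (lookup∘tabulate (ψ ∘ name) f))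

  matching-injective : ∀ {g g′} → ⟦ matching g ⟧ ≡ ⟦ matching g′ ⟧ → ∀ i → i < n → g i ≡ g′ i
  matching-injective {g} {g′} eq i i<n = trans (sym (word-matching g i)) (trans decoded (word-matching g′ i))
    where
    same : ∀ e → ValidE n e → matching g e ≡ matching g′ e
    same e v = ⟦⟧-injective eq {e} v
    decoded : word (matching g) i ≡ word (matching g′) i
    decoded rewrite same (mid i) i<n | same (edge i top ℓ) i<n
                  | same (edge i top v₁) i<n | same (edge i bot v₁) i<n = refl

  matching-coveredOnce : ∀ {g} → Admissible g → EndsAt n g → All (CoveredOnce ⟦ matching g ⟧) vs
  matching-coveredOnce {g} adm end = tabulateᴬ λ p∈ → go (vertices⁻ p∈)
    where
    valid : ∀ v → ValidV n v → ∀ {e} → e ∈ˡ inc v → matching g e ≡ true → ValidE n e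
    valid (port zero s)    h 1st _ = h
    valid (port zero s)    h 2nd _ = h
    valid (port (suc i) s) h 1st _ = h
    valid (port (suc i) s) h 2nd l with suc i <? n
    ... | yes i<n = i<n
    ... | no  i≮n = contradiction (trans (sym (uses-ℓ (g (suc i)) s)) l)
                      λ l → true≢false l (cong isˡ (end (suc i) (≮⇒≥ i≮n)))
    valid (port (suc i) s) h 3rd _ = h
    valid (node i s p₁) h 1st _ = h
    valid (node i s p₁) h 2nd _ = h
    valid (node i s p₁) h 3rd _ = h
    valid (node i s p₂) h 1st _ = h
    valid (node i s p₂) h 2nd _ = h
    valid (node i s p₂) h 3rd _ = h
    valid (node i s p₃) h 1st _ = h
    valid (node i s p₃) h 2nd _ = h
    valid (node i s p₃) h 3rd _ = h
    valid (node i s q₁) h 1st _ = h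
    valid (node i s q₁) h 2nd _ = h
    valid (node i s q₂) h 1st _ = h
    valid (node i s q₂) h 2nd _ = h
    valid (node i s q₃) h 1st _ = h
    valid (node i s q₃) h 2nd _ = h

    go : ∀ {p} → (∃ λ v → ValidV n v × p ≡ point v) → CoveredOnce ⟦ matching g ⟧ p
    go (v , h , refl) = covered⇒coveredOnce (matching g) v (valid v h) (matching-covers adm v)

  coveredOnce-matching : ∀ {M} → All (CoveredOnce M) vs →
                         ∃ λ g → Admissible g × EndsAt n g × M ≡ ⟦ matching g ⟧
  coveredOnce-matching {M} cov = word (χ M) , word-admissible , word-ends , ⟦⟧-unique φ-matching
    where open Decode n (χ M) (λ _ → χ-valid M) (λ v h → coveredOnce⇒covered M v (lookupᴬ cov (vertices⁺ h)))

  perfectMatching : ∀ {g} → Admissible g → EndsAt n g → PerfectMatching ⟦ matching g ⟧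
  perfectMatching adm end = ⊆⊤ , matching-coveredOnce adm end

  blockerSet : Word → EdgeSet
  blockerSet g = ⟦ (λ e → does (e ∈ˡ? allBlockers n g)) ⟧

  ∈-blockerSet⁺ : ∀ g {f} → name f ∈ˡ allBlockers n g → f ∈ blockerSet g
  ∈-blockerSet⁺ g h = ∈⟦⟧⁺ (λ e → does (e ∈ˡ? allBlockers n g)) (dec-true (_ ∈ˡ? _) h)

  ∈-blockerSet⁻ : ∀ g {f} → f ∈ blockerSet g → name f ∈ˡ allBlockers n g
  ∈-blockerSet⁻ g {f} h with name f ∈ˡ? allBlockers n g | ∈⟦⟧⁻ (λ e → does (e ∈ˡ? allBlockers n g)) h
  ... | yes p | _ = p

  blockerSet-antiForcing : ∀ {g} → Admissible g → EndsAt n g → AntiForcing ⟦ matching g ⟧ (blockerSet g)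
  blockerSet-antiForcing {g} adm end =
    (λ f∈S → x∉p⇒x∈∁p λ f∈M → disjoint f∈S f∈M) ,
    ((λ f∈M → x∉p⇒x∈∁p λ f∈S → disjoint f∈S f∈M) , matching-coveredOnce adm end) , unique
    where
    disjoint : ∀ {f} → f ∈ blockerSet g → f ∉ ⟦ matching g ⟧
    disjoint f∈S f∈M
      with _ , e∈ , xs∈ ← ∈-concat⁻′ (applyUpTo (λ i → blockers (g i) i) n) (∈-blockerSet⁻ g f∈S)
      with i , _ , refl ← ∈-applyUpTo⁻ _ xs∈ =
      true≢false (∈⟦⟧⁻ (matching g) f∈M) (lookupᴬ (avoids-blockers g i) e∈)

    unique : ∀ N → PerfectMatchingIn (∁ (blockerSet g)) N → N ≡ ⟦ matching g ⟧
    unique N (N⊆ , cov) = trans N≡ (⟦⟧-cong λ e _ → matching-cong same e)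
      where
      decoded = coveredOnce-matching cov
      g′   = proj₁ decoded
      end′ = proj₁ (proj₂ (proj₂ decoded))
      N≡   = proj₂ (proj₂ (proj₂ decoded))

      avoids : ∀ i → i < n → Avoids g′ (blockers (g i) i)
      avoids i i<n = tabulateᴬ λ e∈ → ¬-not (meets e∈)
        where
        meets : ∀ {e} → e ∈ˡ blockers (g i) i → matching g′ e ≢ true
        meets e∈ h with f , refl ← position (lookupᴬ (blockers-valid (g i) i<n) e∈) =
          x∈∁p⇒x∉p (N⊆ (subst (f ∈_) (sym N≡) (∈⟦⟧⁺ (matching g′) h)))
            (∈-blockerSet⁺ g (∈-concat⁺′ e∈ (∈-applyUpTo⁺ (λ i → blockers (g i) i) i<n)))

      open Blocked {n} {g} {g′} adm end′ avoids

      same : ∀ i → g′ i ≡ g i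
      same i with i <? n
      ... | yes i<n = agree i i<n
      ... | no  i≮n = trans (end′ i (≮⇒≥ i≮n)) (sym (end i (≮⇒≥ i≮n)))

  af-upper : ∀ {g} → Admissible g → EndsAt n g → af ⟦ matching g ⟧ ≤ wordWeight n g
  af-upper {g} adm end = begin
    af ⟦ matching g ⟧                          ≤⟨ af-minimal (blockerSet-antiForcing adm end) ⟩
    ∣ blockerSet g ∣                           ≡⟨ length-elements (blockerSet g) ⟨
    length (elements (blockerSet g))           ≡⟨ length-map name (elements (blockerSet g)) ⟨
    length (map name (elements (blockerSet g))) ≤⟨ length-mono (Unique.map⁺ name-injective
                                                   (elements-unique (blockerSet g))) within ⟩
    length (allBlockers n g)                   ≡⟨ length-allBlockers n g ⟩
    wordWeight n g                             ∎
    where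
    open ≤-Reasoning
    within : ∀ {e} → e ∈ˡ map name (elements (blockerSet g)) → e ∈ˡ allBlockers n g
    within e∈ with f , f∈ , refl ← ∈-map⁻ name e∈ = ∈-blockerSet⁻ g (∈-elements⁻ (blockerSet g) f∈)

  antiForcing-lower : ∀ {g S} → Admissible g → EndsAt n g → AntiForcing ⟦ matching g ⟧ S → wordWeight n g ≤ ∣ S ∣
  antiForcing-lower {g} {S} adm end (S⊆ , _ , unique) = begin
    wordWeight n g                                    ≡⟨ length-allSlots n g ⟨
    length (allSlots n g)                             ≤⟨ length-mono (allSlots-unique n g) hit ⟩
    length (map (owner g ∘ name) (elements S))        ≡⟨ length-map (owner g ∘ name) (elements S) ⟩
    length (elements S)                               ≡⟨ length-elements S ⟩
    ∣ S ∣                                             ∎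
    where
    open ≤-Reasoning
    hit : ∀ {o} → o ∈ˡ allSlots n g → o ∈ˡ map (owner g ∘ name) (elements S)
    hit {i , σ} o∈ with i<n , σ∈ ← ∈-allSlots⁻ n g o∈ with nonempty? (⟦ matching g′ ⟧ ∩ S)
      where open Move (move adm end i<n σ∈)
    ... | yes (f , f∈) with f∈M′ , f∈S ← x∈p∩q⁻ _ S f∈ =
      subst (_∈ˡ _) (owned (name f) (∈⟦⟧⁻ (matching g′) f∈M′) (¬-not λ h → x∈∁p⇒x∉p (S⊆ f∈S) (∈⟦⟧⁺ (matching g) h)))
        (∈-map⁺ (owner g ∘ name) (∈-elements⁺ f∈S))
      where open Move (move adm end i<n σ∈)
    ... | no empty = contradiction (matching-injective (unique ⟦ matching g′ ⟧
        ((λ f∈M′ → x∉p⇒x∈∁p λ f∈S → empty (_ , x∈p∩q⁺ (f∈M′ , f∈S))) , matching-coveredOnce admissible endsAt)) _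
          (proj₁ (proj₂ changed))) (proj₂ (proj₂ changed))
      where open Move (move adm end i<n σ∈)

  af-matching : ∀ {g} → Admissible g → EndsAt n g → af ⟦ matching g ⟧ ≡ wordWeight n g
  af-matching adm end = let S , antiForcing , eq = af-attained (perfectMatching adm end) in
    ≤-antisym (af-upper adm end) (subst (_ ≤_) eq (antiForcing-lower adm end antiForcing))

  encode : Vec Fragment n → EdgeSet
  encode w = ⟦ matching (get w) ⟧

  perfectMatchings-↭ : perfectMatchings ↭ map encode (words n)
  perfectMatchings-↭ = ∼bag⇒↭ (unique∧set⇒bag
    (Unique.filter⁺ (perfectMatchingIn? ⊤) (subsets-unique _))
    (Unique.map⁺ (λ {w} {w′} eq → get-injective w w′ (matching-injective eq)) (words-unique n))
    (mk⇔ to from))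
    where
    to : ∀ {M} → M ∈ˡ perfectMatchings → M ∈ˡ map encode (words n)
    to M∈ = let _ , _ , cov = ∈-filter⁻ (perfectMatchingIn? ⊤) {xs = subsets _} M∈
                g , adm , end , M≡ = coveredOnce-matching cov
            in subst (_∈ˡ map encode (words n))
                 (trans (⟦⟧-cong λ e _ → matching-cong (get-prefix n end) e) (sym M≡))
                 (∈-map⁺ encode (∈-words⁺ {w = prefix n g} (admissible-cong (sym ∘ get-prefix n end) adm)))

    from : ∀ {M} → M ∈ˡ map encode (words n) → M ∈ˡ perfectMatchings
    from M∈ with w , w∈ , refl ← ∈-map⁻ encode M∈ =
      ∈-filter⁺ (perfectMatchingIn? ⊤) (∈-subsets _) (perfectMatching (∈-words⁻ w∈) (get-ends w))

  afSum-totalWeight : afSum ≡ totalWeight (words n)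
  afSum-totalWeight = begin
    sum (map af perfectMatchings)          ≡⟨ sum-↭ (↭-map⁺ af perfectMatchings-↭) ⟩
    sum (map af (map encode (words n)))    ≡⟨ cong sum (map-∘ (words n)) ⟨
    sum (map (af ∘ encode) (words n))      ≡⟨ cong sum (map-cong-local (tabulateᴬ λ {w} w∈ →
                                                trans (af-matching (∈-words⁻ w∈) (get-ends w)) (wordWeight-get w))) ⟩
    totalWeight (words n)                  ∎
    where open ≡-Reasoning

afSum-H : ∀ n → Graph.afSum (H n) ≡ totalWeight (words n)
afSum-H n = PyreneSystem.afSum-totalWeight
  n (Graph.vertices (H n)) (Graph.edges (H n)) (Graph.endpoints (H n)) (H-isPyreneSystem n)

-- The recurrence and its solution

-- (3 + 2√2)ⁿ = x + 2z√2 for (x , z) = pell n.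
pell : ℕ → ℕ × ℕ
pell zero    = 1 , 0
pell (suc n) = let x , z = pell n in 3 *ⁿ x +ⁿ 8 *ⁿ z , x +ⁿ 3 *ⁿ z

length-words : ∀ n → let x , z = pell n in
  length (words n) ≡ x +ⁿ 3 *ⁿ z × length (tameWords n) ≡ x +ⁿ 2 *ⁿ z
length-words zero    = refl , refl
length-words (suc n) with pell n | length-words n
... | x , z | eqʷ , eqᵗ
  rewrite length-extend (inˡ ∷ tameFragments) (words n) (tameWords n)
        | length-extend tameFragments (words n) (tameWords n) | eqʷ | eqᵗ = step₁ x z , step₂ x z
  where
  step₁ : ∀ x z → let p = x +ⁿ 3 *ⁿ z ; q = x +ⁿ 2 *ⁿ z in
    p +ⁿ (p +ⁿ (p +ⁿ (p +ⁿ (p +ⁿ (q +ⁿ 0))))) ≡ 3 *ⁿ x +ⁿ 8 *ⁿ z +ⁿ 3 *ⁿ (x +ⁿ 3 *ⁿ z)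
  step₁ = solve-∀
  step₂ : ∀ x z → let p = x +ⁿ 3 *ⁿ z ; q = x +ⁿ 2 *ⁿ z in
    p +ⁿ (p +ⁿ (p +ⁿ (p +ⁿ (q +ⁿ 0)))) ≡ 3 *ⁿ x +ⁿ 8 *ⁿ z +ⁿ 2 *ⁿ (x +ⁿ 3 *ⁿ z)
  step₂ = solve-∀

-- With p, q the lengths and s, u the total weights of words n and tameWords n,
-- the next totals are 5s + u + 11p + q and 4s + u + 10p + q.
totalWeight-words : ∀ n → let x , z = pell n in
  8 *ⁿ totalWeight (words n) +ⁿ 3 *ⁿ z ≡ n *ⁿ (17 *ⁿ x +ⁿ 48 *ⁿ z) ×
  8 *ⁿ totalWeight (tameWords n) ≡ n *ⁿ (14 *ⁿ x +ⁿ 40 *ⁿ z) +ⁿ 6 *ⁿ z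
totalWeight-words zero    = refl , refl
totalWeight-words (suc n) with pell n | length-words n | totalWeight-words n
... | x , z | eqʷ , eqᵗ | ihʷ , ihᵗ
  rewrite totalWeight-extend (inˡ ∷ tameFragments) (words n) (tameWords n)
        | totalWeight-extend tameFragments (words n) (tameWords n) | eqʷ | eqᵗ =
    +-cancelʳ-≡ (15 *ⁿ z) _ _ (trans (step₁ x z s u)
      (trans (cong₂ (λ a b → 5 *ⁿ a +ⁿ b +ⁿ (99 *ⁿ x +ⁿ 289 *ⁿ z)) ihʷ ihᵗ) (step₁′ n x z)))
  , +-cancelʳ-≡ (12 *ⁿ z) _ _ (trans (step₂ x z s u)
      (trans (cong₂ (λ a b → 4 *ⁿ a +ⁿ b +ⁿ (88 *ⁿ x +ⁿ 256 *ⁿ z)) ihʷ ihᵗ) (step₂′ n x z)))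
  where
  s = totalWeight (words n)
  u = totalWeight (tameWords n)
  step₁ : ∀ x z s u → let p = x +ⁿ 3 *ⁿ z ; q = x +ⁿ 2 *ⁿ z in
    8 *ⁿ (1 *ⁿ p +ⁿ s +ⁿ (3 *ⁿ p +ⁿ s +ⁿ (2 *ⁿ p +ⁿ s +ⁿ (2 *ⁿ p +ⁿ s +ⁿ (3 *ⁿ p +ⁿ s +ⁿ (1 *ⁿ q +ⁿ u +ⁿ 0))))))
      +ⁿ 3 *ⁿ (x +ⁿ 3 *ⁿ z) +ⁿ 15 *ⁿ z
    ≡ 5 *ⁿ (8 *ⁿ s +ⁿ 3 *ⁿ z) +ⁿ 8 *ⁿ u +ⁿ (99 *ⁿ x +ⁿ 289 *ⁿ z)
  step₁ = solve-∀
  step₁′ : ∀ n x z →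
    5 *ⁿ (n *ⁿ (17 *ⁿ x +ⁿ 48 *ⁿ z)) +ⁿ (n *ⁿ (14 *ⁿ x +ⁿ 40 *ⁿ z) +ⁿ 6 *ⁿ z) +ⁿ (99 *ⁿ x +ⁿ 289 *ⁿ z)
    ≡ suc n *ⁿ (17 *ⁿ (3 *ⁿ x +ⁿ 8 *ⁿ z) +ⁿ 48 *ⁿ (x +ⁿ 3 *ⁿ z)) +ⁿ 15 *ⁿ z
  step₁′ = solve-∀
  step₂ : ∀ x z s u → let p = x +ⁿ 3 *ⁿ z ; q = x +ⁿ 2 *ⁿ z in
    8 *ⁿ (3 *ⁿ p +ⁿ s +ⁿ (2 *ⁿ p +ⁿ s +ⁿ (2 *ⁿ p +ⁿ s +ⁿ (3 *ⁿ p +ⁿ s +ⁿ (1 *ⁿ q +ⁿ u +ⁿ 0))))) +ⁿ 12 *ⁿ z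
    ≡ 4 *ⁿ (8 *ⁿ s +ⁿ 3 *ⁿ z) +ⁿ 8 *ⁿ u +ⁿ (88 *ⁿ x +ⁿ 256 *ⁿ z)
  step₂ = solve-∀
  step₂′ : ∀ n x z →
    4 *ⁿ (n *ⁿ (17 *ⁿ x +ⁿ 48 *ⁿ z)) +ⁿ (n *ⁿ (14 *ⁿ x +ⁿ 40 *ⁿ z) +ⁿ 6 *ⁿ z) +ⁿ (88 *ⁿ x +ⁿ 256 *ⁿ z)
    ≡ suc n *ⁿ (14 *ⁿ (3 *ⁿ x +ⁿ 8 *ⁿ z) +ⁿ 40 *ⁿ (x +ⁿ 3 *ⁿ z)) +ⁿ 6 *ⁿ (x +ⁿ 3 *ⁿ z) +ⁿ 12 *ⁿ z
  step₂′ = solve-∀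

ι : ℕ → ℚ
ι k = ℤ.+ k / 1

private
  toℚᵘ-ι : ∀ k → toℚᵘ (ι k) ℚᵘ.≃ ℚᵘ.mkℚᵘ (ℤ.+ k) 0
  toℚᵘ-ι k = ℚ.toℚᵘ-fromℚᵘ (ℚᵘ.mkℚᵘ (ℤ.+ k) 0)

ι-+ : ∀ a b → ι (a +ⁿ b) ≡ ι a ℚ.+ ι b
ι-+ a b = ℚ.toℚᵘ-injective (begin
  toℚᵘ (ι (a +ⁿ b))                      ≈⟨ toℚᵘ-ι (a +ⁿ b) ⟩
  ℚᵘ.mkℚᵘ (ℤ.+ (a +ⁿ b)) 0               ≈⟨ ℚᵘ.*≡* (cong (ℤ._* ℤ.+ 1)
                                              (sym (cong₂ ℤ._+_ (ℤ.*-identityʳ (ℤ.+ a)) (ℤ.*-identityʳ (ℤ.+ b))))) ⟩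
  ℚᵘ.mkℚᵘ (ℤ.+ a) 0 ℚᵘ.+ ℚᵘ.mkℚᵘ (ℤ.+ b) 0 ≈⟨ ℚᵘ.+-cong (toℚᵘ-ι a) (toℚᵘ-ι b) ⟨
  toℚᵘ (ι a) ℚᵘ.+ toℚᵘ (ι b)             ≈⟨ ℚ.toℚᵘ-homo-+ (ι a) (ι b) ⟨
  toℚᵘ (ι a ℚ.+ ι b)                     ∎)
  where open ℚᵘ.≃-Reasoning

ι-* : ∀ a b → ι (a *ⁿ b) ≡ ι a ℚ.* ι b
ι-* a b = ℚ.toℚᵘ-injective (begin
  toℚᵘ (ι (a *ⁿ b))                      ≈⟨ toℚᵘ-ι (a *ⁿ b) ⟩
  ℚᵘ.mkℚᵘ (ℤ.+ (a *ⁿ b)) 0               ≈⟨ ℚᵘ.*≡* (cong (ℤ._* ℤ.+ 1) (ℤ.pos-* a b)) ⟩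
  ℚᵘ.mkℚᵘ (ℤ.+ a) 0 ℚᵘ.* ℚᵘ.mkℚᵘ (ℤ.+ b) 0 ≈⟨ ℚᵘ.*-cong (toℚᵘ-ι a) (toℚᵘ-ι b) ⟨
  toℚᵘ (ι a) ℚᵘ.* toℚᵘ (ι b)             ≈⟨ ℚ.toℚᵘ-homo-* (ι a) (ι b) ⟨
  toℚᵘ (ι a ℚ.* ι b)                     ∎)
  where open ℚᵘ.≃-Reasoning

ι-lin : ∀ a b x z → ι (a *ⁿ x +ⁿ b *ⁿ z) ≡ ι a ℚ.* ι x ℚ.+ ι b ℚ.* ι z
ι-lin a b x z = trans (ι-+ (a *ⁿ x) (b *ⁿ z)) (cong₂ ℚ._+_ (ι-* a x) (ι-* b z))

3+2√2^ : ∀ n → let x , z = pell n in (# 3 + # 2 * √2) ^ n ≡ (ι x +√2 ι 2 ℚ.* ι z)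
3+2√2^ zero    = refl
3+2√2^ (suc n) = let x , z = pell n in
  trans (cong ((# 3 + # 2 * √2) *_) (3+2√2^ n)) (cong₂ _+√2_
    (trans (solve 2 (λ x z → con (ι 3) :* x :+ con (ι 2) :* (con (ι 2) :* (con (ι 2) :* z))
                             := con (ι 3) :* x :+ con (ι 8) :* z) refl (ι x) (ι z))
           (sym (ι-lin 3 8 x z)))
    (trans (solve 2 (λ x z → con (ι 3) :* (con (ι 2) :* z) :+ con (ι 2) :* x
                             := con (ι 2) :* (x :+ con (ι 3) :* z)) refl (ι x) (ι z))
           (cong (ι 2 ℚ.*_) (sym (trans (ι-+ x (3 *ⁿ z)) (cong (ι x ℚ.+_) (ι-* 3 z)))))))
  where open +-*-Solver

3-2√2^ : ∀ n → let x , z = pell n in (# 3 - # 2 * √2) ^ n ≡ (ι x +√2 ℚ.- (ι 2 ℚ.* ι z))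
3-2√2^ zero    = refl
3-2√2^ (suc n) = let x , z = pell n in
  trans (cong ((# 3 - # 2 * √2) *_) (3-2√2^ n)) (cong₂ _+√2_
    (trans (solve 2 (λ x z → con (ι 3) :* x :+ con (ι 2) :* (con (ℚ.- ι 2) :* (:- (con (ι 2) :* z)))
                             := con (ι 3) :* x :+ con (ι 8) :* z) refl (ι x) (ι z))
           (sym (ι-lin 3 8 x z)))
    (trans (solve 2 (λ x z → con (ι 3) :* (:- (con (ι 2) :* z)) :+ con (ℚ.- ι 2) :* x
                             := :- (con (ι 2) :* (x :+ con (ι 3) :* z))) refl (ι x) (ι z))
           (cong (λ q → ℚ.- (ι 2 ℚ.* q)) (sym (trans (ι-+ x (3 *ⁿ z)) (cong (ι x ℚ.+_) (ι-* 3 z)))))))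
  where open +-*-Solver

closedForm : ∀ n s → let x , z = pell n in
  8 *ⁿ s +ⁿ 3 *ⁿ z ≡ n *ⁿ (17 *ⁿ x +ⁿ 48 *ⁿ z) →
  # s ≡
    (# 3 * √2 ÷ 64) * (# 3 - # 2 * √2) ^ n
    + ((# 17 - # 12 * √2) ÷ 16) * # n * (# 3 - # 2 * √2) ^ n
    - (# 3 * √2 ÷ 64) * (# 3 + # 2 * √2) ^ n
    + ((# 17 + # 12 * √2) ÷ 16) * # n * (# 3 + # 2 * √2) ^ n
closedForm n s eq rewrite 3-2√2^ n | 3+2√2^ n = let x , z = pell n in
  sym (cong₂ _+√2_
    (trans (rational (ι n) (ι x) (ι z))
      (trans (cong (λ q → ⅛ ℚ.* (q ℚ.- ι 3 ℚ.* ι z)) (sym (eqᵠ x z eq))) (cancel (ι s) (ι z))))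
    (irrational (ι n) (ι x) (ι z)))
  where
  open +-*-Solver

  ⅛ : ℚ
  ⅛ = ℤ.+ 1 / 8

  cancel : ∀ s z → ⅛ ℚ.* (ι 8 ℚ.* s ℚ.+ ι 3 ℚ.* z ℚ.- ι 3 ℚ.* z) ≡ s
  cancel = solve 2 (λ s z → con ⅛ :* (con (ι 8) :* s :+ con (ι 3) :* z :- con (ι 3) :* z) := s) refl

  eqᵠ : ∀ x z → 8 *ⁿ s +ⁿ 3 *ⁿ z ≡ n *ⁿ (17 *ⁿ x +ⁿ 48 *ⁿ z) →
        ι 8 ℚ.* ι s ℚ.+ ι 3 ℚ.* ι z ≡ ι n ℚ.* (ι 17 ℚ.* ι x ℚ.+ ι 48 ℚ.* ι z)
  eqᵠ x z h = trans (sym (ι-lin 8 3 s z)) (trans (cong ι h)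
    (trans (ι-* n (17 *ⁿ x +ⁿ 48 *ⁿ z)) (cong (ι n ℚ.*_) (ι-lin 17 48 x z))))

  rational : ∀ n x z → ℚ[√2].rat (
    (# 3 * √2 ÷ 64) * (x +√2 ℚ.- (ι 2 ℚ.* z))
    + ((# 17 - # 12 * √2) ÷ 16) * (n +√2 0ℚ) * (x +√2 ℚ.- (ι 2 ℚ.* z))
    - (# 3 * √2 ÷ 64) * (x +√2 ι 2 ℚ.* z)
    + ((# 17 + # 12 * √2) ÷ 16) * (n +√2 0ℚ) * (x +√2 ι 2 ℚ.* z))
    ≡ ⅛ ℚ.* (n ℚ.* (ι 17 ℚ.* x ℚ.+ ι 48 ℚ.* z) ℚ.- ι 3 ℚ.* z)
  rational = solve 3 (λ n x z →
    ((con 0ℚ :* x :+ con (ι 2) :* (con (ℤ.+ 3 / 64) :* (:- (con (ι 2) :* z)))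
    :+ ((con (ℤ.+ 17 / 16) :* n :+ con (ι 2) :* (con (ℤ.- (ℤ.+ 12) / 16) :* con 0ℚ)) :* x
       :+ con (ι 2) :* ((con (ℤ.+ 17 / 16) :* con 0ℚ :+ con (ℤ.- (ℤ.+ 12) / 16) :* n) :* (:- (con (ι 2) :* z)))))
    :- (con 0ℚ :* x :+ con (ι 2) :* (con (ℤ.+ 3 / 64) :* (con (ι 2) :* z))))
    :+ ((con (ℤ.+ 17 / 16) :* n :+ con (ι 2) :* (con (ℤ.+ 12 / 16) :* con 0ℚ)) :* x
       :+ con (ι 2) :* ((con (ℤ.+ 17 / 16) :* con 0ℚ :+ con (ℤ.+ 12 / 16) :* n) :* (con (ι 2) :* z)))
    := con ⅛ :* (n :* (con (ι 17) :* x :+ con (ι 48) :* z) :- con (ι 3) :* z)) refl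

  irrational : ∀ n x z → ℚ[√2].irr (
    (# 3 * √2 ÷ 64) * (x +√2 ℚ.- (ι 2 ℚ.* z))
    + ((# 17 - # 12 * √2) ÷ 16) * (n +√2 0ℚ) * (x +√2 ℚ.- (ι 2 ℚ.* z))
    - (# 3 * √2 ÷ 64) * (x +√2 ι 2 ℚ.* z)
    + ((# 17 + # 12 * √2) ÷ 16) * (n +√2 0ℚ) * (x +√2 ι 2 ℚ.* z))
    ≡ 0ℚ
  irrational = solve 3 (λ n x z →
    ((con 0ℚ :* (:- (con (ι 2) :* z)) :+ con (ℤ.+ 3 / 64) :* x
    :+ ((con (ℤ.+ 17 / 16) :* n :+ con (ι 2) :* (con (ℤ.- (ℤ.+ 12) / 16) :* con 0ℚ)) :* (:- (con (ι 2) :* z))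
       :+ (con (ℤ.+ 17 / 16) :* con 0ℚ :+ con (ℤ.- (ℤ.+ 12) / 16) :* n) :* x))
    :- (con 0ℚ :* (con (ι 2) :* z) :+ con (ℤ.+ 3 / 64) :* x))
    :+ ((con (ℤ.+ 17 / 16) :* n :+ con (ι 2) :* (con (ℤ.+ 12 / 16) :* con 0ℚ)) :* (con (ι 2) :* z)
       :+ (con (ℤ.+ 17 / 16) :* con 0ℚ :+ con (ℤ.+ 12 / 16) :* n) :* x)
    := con 0ℚ) refl

theorem4p4 : (n : ℕ) →
    # Graph.afSum (H n) ≡
    (# 3 * √2 ÷ 64) * (# 3 - # 2 * √2) ^ n
    + ((# 17 - # 12 * √2) ÷ 16) * # n * (# 3 - # 2 * √2) ^ n
    - (# 3 * √2 ÷ 64) * (# 3 + # 2 * √2) ^ n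
    + ((# 17 + # 12 * √2) ÷ 16) * # n * (# 3 + # 2 * √2) ^ n
theorem4p4 n = closedForm n (Graph.afSum (H n))
  (trans (cong (λ s → 8 *ⁿ s +ⁿ 3 *ⁿ proj₂ (pell n)) (afSum-H n)) (proj₁ (totalWeight-words n)))
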